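{- Let $n,d\ge1$ and let $P_1,\dots,P_d$ be independent uniformly random $n\times n$ permutation matrices; put $M_\Lambda=P_1+\cdots+P_d$, the adjacency matrix of a random $d$-regular directed multigraph $\Lambda$ on $[n]$. For $A,B\subset[n]$ let $e_\Lambda(A,B)=\sum_{i\in A,\,j\in B}M_\Lambda(i,j)$ be the number of directed edges from $A$ to $B$ counted with multiplicity, and let $\mu=\frac{d}{n}|A||B|$. Then for any $\tau\ge0$, $$\mathbb{P}\big(|e_\Lambda(A,B)-\mu|\ge\tau\mu\big)\le 2\exp\!\left(-\frac{\tau^2\mu}{2+\tau}\right).$$
   Formalization: The parameter τ ranges over nonnegative rationals instead of nonnegative reals, and the bound by 2exp(-x) is stated equivalently as probability times every partial sum of the series of exp(x) being at most 2. -}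

module Defs where

open import Data.Nat as ℕ using (ℕ; zero; suc; _!)
open import Data.Nat.Properties using (_!≢0)
open import Data.Integer using (+_)
open import Data.Rational as ℚ using (ℚ; 0ℚ; 1ℚ; _+_; _*_; _-_; _≤_; ∣_∣; _÷_)
import Data.Rational.Properties as ℚP
open import Data.Fin using (Fin)
open import Data.Fin.Properties using (_≟_)
open import Data.Fin.Subset using (Subset; _∈_) renaming (∣_∣ to size)
open import Data.Fin.Subset.Properties using (_∈?_)
open import Data.Bool using (Bool; true; false; if_then_else_)
open import Data.List as List using (List; []; _∷_; allFin; filter; length; concatMap; map)
open import Data.Nat.ListAction using (sum)
open import Data.Vec as Vec using (Vec; []; _∷_; lookup; toList)
open import Data.List.Relation.Unary.Unique.Propositional using (Unique)
import Data.List.Relation.Unary.Unique.DecPropositional as UDec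
open import Relation.Nullary using (Dec; yes; no; does)
open import Relation.Nullary.Decidable using (⌊_⌋)

allVecs : ∀ {A : Set} → (m : ℕ) → List A → List (Vec A m)
allVecs zero    xs = [] ∷ []
allVecs (suc m) xs = concatMap (λ x → map (x ∷_) (allVecs m xs)) xs

-- a permutation of [n] is represented by the vector (σ(0),…,σ(n-1)) with
-- pairwise distinct entries (an injective, hence bijective, map Fin n → Fin n)
Perm : ℕ → Set
Perm n = Vec (Fin n) n

IsPerm : ∀ {n} → Perm n → Set
IsPerm σ = Unique (toList σ)

isPerm? : ∀ {n} (σ : Perm n) → Dec (IsPerm σ)
isPerm? {n} σ = UDec.unique? (_≟_ {n}) (toList σ)

allPerms : (n : ℕ) → List (Perm n)
allPerms n = filter isPerm? (allVecs n (allFin n))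

-- the sample space: all d-tuples (σ_1,…,σ_d) of permutations, each equally likely
Ω : (n d : ℕ) → List (Vec (Perm n) d)
Ω n d = allVecs d (allPerms n)

permMatrix : ∀ {n} → Perm n → Fin n → Fin n → ℕ
permMatrix σ i j = if ⌊ lookup σ i ≟ j ⌋ then 1 else 0

M : ∀ {n d} → Vec (Perm n) d → Fin n → Fin n → ℕ
M {n} σs i j = sum (map (λ σ → permMatrix σ i j) (toList σs))

sumOver : ∀ {n} → Subset n → (Fin n → ℕ) → ℕ
sumOver {n} A f = sum (map (λ i → if ⌊ i ∈? A ⌋ then f i else 0) (allFin n))

eΛ : ∀ {n d} → Vec (Perm n) d → Subset n → Subset n → ℕ
eΛ σs A B = sumOver A (λ i → sumOver B (λ j → M σs i j))

ℕ→ℚ : ℕ → ℚ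
ℕ→ℚ k = + k ℚ./ 1

μ : ∀ (n d : ℕ) .{{_ : ℕ.NonZero n}} → Subset n → Subset n → ℚ
μ n d A B = ((+ d) ℚ./ n) * ℕ→ℚ (size A) * ℕ→ℚ (size B)

_^_ : ℚ → ℕ → ℚ
x ^ zero  = 1ℚ
x ^ suc k = x * (x ^ k)

expPartial : ℕ → ℚ → ℚ
expPartial zero    x = 0ℚ
expPartial (suc N) x = expPartial N x + (x ^ N) * ((+ 1) ℚ./ (N !))
  where instance _ = N !≢0

exponent : (τ m : ℚ) → 0ℚ ≤ τ → ℚ
exponent τ m 0≤τ = (τ * τ * m) ÷ (ℚ.1ℚ + ℚ.1ℚ + τ)
  where
  instance
    _ = ℚP.pos⇒nonZero (ℚ.1ℚ + ℚ.1ℚ + τ)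
        {{ℚ.positive (ℚP.+-mono-<-≤ {0ℚ} {ℚ.1ℚ + ℚ.1ℚ} {0ℚ} {τ} (ℚP.positive⁻¹ _) 0≤τ)}}

badCount : ∀ (n d : ℕ) .{{_ : ℕ.NonZero n}} → Subset n → Subset n → ℚ → ℕ
badCount n d A B τ =
  length (filter (λ σs → τ * μ n d A B ℚ.≤? ∣ ℕ→ℚ (eΛ σs A B) - μ n d A B ∣) (Ω n d))

{-# OPTIONS --safe #-}
module Submission where

-- Chernoff's method.  For a uniformly random permutation σ and w = t on B, 1 off B, the mean of
-- ∏_{i ∈ A} w(σ i) is the elementary symmetric mean of degree |A| of w, so Maclaurin's inequality
-- bounds it by (1 - p + p t)^|A| with p = |B| / n; independence raises this to the power d.  Markov's
-- inequality is applied with t = 1 + τ for the upper tail and, for the lower tail, with t = 1 - τ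
-- (if τ < 1) or t = 1/2 (if τ ≥ 1, where the tail forces e_Λ(A,B) = 0).  The real exponential is never
-- needed: the estimates e^y ≤ (1 + y/2)/(1 - y/2), (1 - u) e^u ≤ 1 and 1 + v + v²/2 ≤ e^v hold, in the form
-- of bounds on the change from x to x + u, for the partial sums, because all
-- derivatives of x^k / k! are nonnegative on x ≥ 0.

open import Defs
open import Data.Bool using (Bool; true; false; if_then_else_; not; _∧_)
open import Data.Empty using (⊥-elim)
open import Data.Fin using (Fin; zero; suc)
open import Data.Fin.Properties using (_≟_)
open import Data.Fin.Subset using (Subset; ∁) renaming (∣_∣ to size; ⊥ to ∅)
open import Data.Fin.Subset.Properties using (_∈?_; ∣p∣≤n; ∣⊥∣≡0)
import Data.Integer as ℤ
import Data.Integer.Properties as ℤP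
open import Data.List using (List; []; _∷_; _++_; map; concatMap; filter; length; allFin; tabulate)
open import Data.List.Properties using (map-tabulate; filter-all)
open import Data.List.Membership.Propositional using (_∈_)
open import Data.List.Relation.Unary.All as All using (all?)
open import Data.List.Relation.Unary.AllPairs using (_∷_)
open import Data.List.Relation.Unary.Any using (here; there)
open import Data.List.Relation.Unary.Unique.Propositional using (Unique)
import Data.List.Relation.Unary.Unique.DecPropositional as UniqueDec
import Data.List.Relation.Unary.Unique.Propositional.Properties as Unique
open import Data.Nat as ℕ using (ℕ; zero; suc; pred; _!)
open import Data.Nat.ListAction using (sum)
import Data.Nat.Properties as ℕP
open import Data.Nat.Properties using (_!≢0)
open import Data.Product using (∃; _×_; _,_; proj₁; proj₂)
open import Data.Rational as ℚ using (ℚ; 0ℚ; 1ℚ; ½; _+_; _*_; _-_; -_; _≤_; _<_; ∣_∣; toℚᵘ)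
open import Data.Rational.Properties hiding (_≟_)
open import Data.Rational.Solver
open import Data.Rational.Unnormalised as ℚᵘ using (mkℚᵘ; *≡*)
import Data.Rational.Unnormalised.Properties as ℚᵘP
open import Data.Sum using (inj₁; inj₂; [_,_]′)
open import Data.Vec as Vec using (Vec; []; _∷_; lookup; toList)
import Data.Vec.Properties as VecP
open import Function using (_∘_; id)
open import Level using (0ℓ)
open import Relation.Nullary using (Dec; yes; no; does; ¬?)
open import Relation.Nullary.Decidable using (⌊_⌋; isYes≗does; toSum)
open import Relation.Unary using (Pred; Decidable)
open import Relation.Binary.PropositionalEquality
open +-*-Solver using (solve; _:=_; _:+_; _:*_; _:-_; :-_; con)

-- Ordered-field arithmetic and the embedding of ℕ

-- The real bound is read off by letting `N` grow: at an argument x ≥ 0 the partial sums increase to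
-- e^x, and multiplying by `length (Ω n d)` replaces dividing by it. Both tails compare integer
-- powers with partial sums. Absorbing a factor 1 + u or 1/(1 - τ) into a partial sum costs a higher
-- truncation order. This does no harm, because the estimates that close the argument, a partial sum
-- at e · 2τ/(2 + τ) being at most (1 + τ)^e and (1 - u)^K times a partial sum at K u being at most
-- 1, hold at every order.
--
-- The exponent comes out exactly. For the upper tail, log(1 + τ) ≥ 2τ/(2 + τ) gives (1 + τ) · 2τ/(2
-- + τ) - τ = τ²/(2 + τ). For the lower tail, -log(1 - τ) ≤ 2τ/((2 + τ)(1 - τ)) gives τ - 2τ/(2 +
-- τ), the same number.
--
-- The values of one permutation are dependent, so its generating function is not a product.
-- Maclaurin's inequality restores a product as an upper bound; it is proved by conditioning on the
-- first draw, with all ratios cleared of denominators.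

0≤1 : 0ℚ ≤ 1ℚ
0≤1 = nonNegative⁻¹ 1ℚ

0≤½ : 0ℚ ≤ ½
0≤½ = nonNegative⁻¹ ½

0≤+ : ∀ {p q} → 0ℚ ≤ p → 0ℚ ≤ q → 0ℚ ≤ p + q
0≤+ = +-mono-≤

*-mono-0≤ˡ : ∀ {p q} r → 0ℚ ≤ r → p ≤ q → r * p ≤ r * q
*-mono-0≤ˡ r 0≤r = *-monoˡ-≤-nonNeg r {{ℚ.nonNegative 0≤r}}

*-mono-0≤ʳ : ∀ {p q} r → 0ℚ ≤ r → p ≤ q → p * r ≤ q * r
*-mono-0≤ʳ r 0≤r = *-monoʳ-≤-nonNeg r {{ℚ.nonNegative 0≤r}}

0≤* : ∀ {p q} → 0ℚ ≤ p → 0ℚ ≤ q → 0ℚ ≤ p * q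
0≤* {p} {q} 0≤p 0≤q = subst (_≤ p * q) (*-zeroʳ p) (*-mono-0≤ˡ p 0≤p 0≤q)

0<* : ∀ {p q} → 0ℚ < p → 0ℚ < q → 0ℚ < p * q
0<* {p} {q} 0<p 0<q = subst (_< p * q) (*-zeroʳ p) (*-monoʳ-<-pos p {{ℚ.positive 0<p}} 0<q)

*-mono-0≤ : ∀ {p q r s} → 0ℚ ≤ p → 0ℚ ≤ s → p ≤ q → r ≤ s → p * r ≤ q * s
*-mono-0≤ {p} {q} {r} {s} 0≤p 0≤s p≤q r≤s =
  ≤-trans (*-mono-0≤ˡ p 0≤p r≤s) (*-mono-0≤ʳ s 0≤s p≤q)

*-cancel-0< : ∀ {p q} r → 0ℚ < r → r * p ≤ r * q → p ≤ q
*-cancel-0< r 0<r = *-cancelˡ-≤-pos r {{ℚ.positive 0<r}}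

≤-diff : ∀ {p q} r → 0ℚ ≤ r → q ≡ p + r → p ≤ q
≤-diff {p} {q} r 0≤r eq = subst₂ _≤_ (+-identityʳ p) (sym eq) (+-monoʳ-≤ p 0≤r)

≤⇒0≤- : ∀ {p q} → p ≤ q → 0ℚ ≤ q - p
≤⇒0≤- {p} {q} p≤q = subst (_≤ q - p) (+-inverseʳ p) (+-mono-≤ p≤q ≤-refl)

/1-homo-+ : ∀ i j → (i ℤ.+ j) ℚ./ 1 ≡ i ℚ./ 1 + j ℚ./ 1
/1-homo-+ i j = toℚᵘ-injective (begin-equality
  toℚᵘ ((i ℤ.+ j) ℚ./ 1)                 ≃⟨ toℚᵘ-fromℚᵘ (mkℚᵘ (i ℤ.+ j) 0) ⟩
  mkℚᵘ (i ℤ.+ j) 0                       ≃⟨ *≡* (cong (ℤ._* ℤ.1ℤ) (sym (cong₂ ℤ._+_ (ℤP.*-identityʳ i) (ℤP.*-identityʳ j)))) ⟩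
  mkℚᵘ i 0 ℚᵘ.+ mkℚᵘ j 0                 ≃⟨ ℚᵘP.+-cong (toℚᵘ-fromℚᵘ (mkℚᵘ i 0)) (toℚᵘ-fromℚᵘ (mkℚᵘ j 0)) ⟨
  toℚᵘ (i ℚ./ 1) ℚᵘ.+ toℚᵘ (j ℚ./ 1)     ≃⟨ toℚᵘ-homo-+ (i ℚ./ 1) (j ℚ./ 1) ⟨
  toℚᵘ (i ℚ./ 1 + j ℚ./ 1)               ∎)
  where open ℚᵘP.≤-Reasoning

ℕ→ℚ-+ : ∀ a b → ℕ→ℚ (a ℕ.+ b) ≡ ℕ→ℚ a + ℕ→ℚ b
ℕ→ℚ-+ a b = /1-homo-+ (ℤ.+ a) (ℤ.+ b)

ℕ→ℚ-suc : ∀ k → ℕ→ℚ (suc k) ≡ 1ℚ + ℕ→ℚ k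
ℕ→ℚ-suc = ℕ→ℚ-+ 1

ℕ→ℚ-* : ∀ a b → ℕ→ℚ (a ℕ.* b) ≡ ℕ→ℚ a * ℕ→ℚ b
ℕ→ℚ-* zero    b = sym (*-zeroˡ (ℕ→ℚ b))
ℕ→ℚ-* (suc a) b = begin
  ℕ→ℚ (b ℕ.+ a ℕ.* b)          ≡⟨ ℕ→ℚ-+ b (a ℕ.* b) ⟩
  ℕ→ℚ b + ℕ→ℚ (a ℕ.* b)        ≡⟨ cong (ℕ→ℚ b +_) (ℕ→ℚ-* a b) ⟩
  ℕ→ℚ b + ℕ→ℚ a * ℕ→ℚ b        ≡⟨ solve 2 (λ a b → b :+ a :* b := (con 1ℚ :+ a) :* b) refl (ℕ→ℚ a) (ℕ→ℚ b) ⟩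
  (1ℚ + ℕ→ℚ a) * ℕ→ℚ b         ≡⟨ cong (_* ℕ→ℚ b) (ℕ→ℚ-suc a) ⟨
  ℕ→ℚ (suc a) * ℕ→ℚ b          ∎
  where open ≡-Reasoning

0≤ℕ→ℚ : ∀ k → 0ℚ ≤ ℕ→ℚ k
0≤ℕ→ℚ zero    = ≤-refl
0≤ℕ→ℚ (suc k) = subst (0ℚ ≤_) (sym (ℕ→ℚ-suc k)) (0≤+ 0≤1 (0≤ℕ→ℚ k))

ℕ→ℚ-mono : ∀ {j k} → j ℕ.≤ k → ℕ→ℚ j ≤ ℕ→ℚ k
ℕ→ℚ-mono {k = k} ℕ.z≤n = 0≤ℕ→ℚ k
ℕ→ℚ-mono {suc j} {suc k} (ℕ.s≤s j≤k) =
  subst₂ _≤_ (sym (ℕ→ℚ-suc j)) (sym (ℕ→ℚ-suc k)) (+-monoʳ-≤ 1ℚ (ℕ→ℚ-mono j≤k))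

ℕ→ℚ-pos : ∀ k → 0ℚ < ℕ→ℚ (suc k)
ℕ→ℚ-pos k = <-≤-trans (positive⁻¹ 1ℚ) (ℕ→ℚ-mono (ℕ.s≤s (ℕ.z≤n {k})))

/-as-* : ∀ a n .{{_ : ℕ.NonZero n}} → (ℤ.+ a) ℚ./ n ≡ ℕ→ℚ a * (ℤ.+ 1 ℚ./ n)
/-as-* a (suc n) = toℚᵘ-injective (begin-equality
  toℚᵘ (ℤ.+ a ℚ./ suc n)                        ≃⟨ toℚᵘ-fromℚᵘ (mkℚᵘ (ℤ.+ a) n) ⟩
  mkℚᵘ (ℤ.+ a) n                                ≃⟨ *≡* (cong₂ ℤ._*_ (sym (ℤP.*-identityʳ (ℤ.+ a))) (cong ℤ.+_ (cong suc (ℕP.+-identityʳ n)))) ⟩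
  mkℚᵘ (ℤ.+ a) 0 ℚᵘ.* mkℚᵘ (ℤ.+ 1) n            ≃⟨ ℚᵘP.*-cong (toℚᵘ-fromℚᵘ (mkℚᵘ (ℤ.+ a) 0)) (toℚᵘ-fromℚᵘ (mkℚᵘ (ℤ.+ 1) n)) ⟨
  toℚᵘ (ℕ→ℚ a) ℚᵘ.* toℚᵘ (ℤ.+ 1 ℚ./ suc n)      ≃⟨ toℚᵘ-homo-* (ℕ→ℚ a) (ℤ.+ 1 ℚ./ suc n) ⟨
  toℚᵘ (ℕ→ℚ a * (ℤ.+ 1 ℚ./ suc n))              ∎)
  where open ℚᵘP.≤-Reasoning

ℕ→ℚ-*-1/ : ∀ n .{{_ : ℕ.NonZero n}} → ℕ→ℚ n * (ℤ.+ 1 ℚ./ n) ≡ 1ℚ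
ℕ→ℚ-*-1/ n@(suc m) = trans (sym (/-as-* n n)) (toℚᵘ-injective (begin-equality
  toℚᵘ (ℤ.+ n ℚ./ n)   ≃⟨ toℚᵘ-fromℚᵘ (mkℚᵘ (ℤ.+ n) m) ⟩
  mkℚᵘ (ℤ.+ n) m       ≃⟨ *≡* (ℤP.*-comm (ℤ.+ n) ℤ.1ℤ) ⟩
  toℚᵘ 1ℚ              ∎))
  where open ℚᵘP.≤-Reasoning

0≤1/ : ∀ n .{{_ : ℕ.NonZero n}} → 0ℚ ≤ ℤ.+ 1 ℚ./ n
0≤1/ n = nonNegative⁻¹ _ {{normalize-nonNeg 1 n}}

0≤^ : ∀ {x} k → 0ℚ ≤ x → 0ℚ ≤ x ^ k
0≤^ zero    0≤x = 0≤1
0≤^ (suc k) 0≤x = 0≤* 0≤x (0≤^ k 0≤x)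

0<^ : ∀ {x} k → 0ℚ < x → 0ℚ < x ^ k
0<^ zero    0<x = positive⁻¹ 1ℚ
0<^ (suc k) 0<x = 0<* 0<x (0<^ k 0<x)

^-mono : ∀ {x y} k → 0ℚ ≤ x → x ≤ y → x ^ k ≤ y ^ k
^-mono zero    0≤x x≤y = ≤-refl
^-mono (suc k) 0≤x x≤y = *-mono-0≤ 0≤x (0≤^ k (≤-trans 0≤x x≤y)) x≤y (^-mono k 0≤x x≤y)

^-distribˡ-+ : ∀ x j k → x ^ (j ℕ.+ k) ≡ x ^ j * x ^ k
^-distribˡ-+ x zero    k = sym (*-identityˡ (x ^ k))
^-distribˡ-+ x (suc j) k = trans (cong (x *_) (^-distribˡ-+ x j k)) (sym (*-assoc x (x ^ j) (x ^ k)))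

^-distribʳ-* : ∀ x y k → (x * y) ^ k ≡ x ^ k * y ^ k
^-distribʳ-* x y zero    = refl
^-distribʳ-* x y (suc k) = trans (cong (x * y *_) (^-distribʳ-* x y k))
  (solve 4 (λ x y p q → x :* y :* (p :* q) := x :* p :* (y :* q)) refl x y (x ^ k) (y ^ k))

^-assoc : ∀ x j k → x ^ (j ℕ.* k) ≡ (x ^ k) ^ j
^-assoc x zero    k = refl
^-assoc x (suc j) k = trans (^-distribˡ-+ x k (j ℕ.* k)) (cong (x ^ k *_) (^-assoc x j k))

1^ : ∀ k → 1ℚ ^ k ≡ 1ℚ
1^ zero    = refl
1^ (suc k) = trans (*-identityˡ _) (1^ k)

-- Partial sums of the exponential series

-- Convexity of powers on b ≥ 0. The induction multiplies by `b + u`, and the surplus is the single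
-- nonnegative term `c * u * u * b ^ k`. Writing the exponent as `suc k` gives its derivative an
-- exponent without a predecessor.
^-tangent : ∀ {b u} k → 0ℚ ≤ b → 0ℚ ≤ u →
  b ^ suc k + ℕ→ℚ (suc k) * u * b ^ k ≤ (b + u) ^ suc k
^-tangent {b} {u} zero 0≤b 0≤u =
  ≤-reflexive (solve 2 (λ b u → b :* con 1ℚ :+ con 1ℚ :* u :* con 1ℚ := (b :+ u) :* con 1ℚ) refl b u)
^-tangent {b} {u} (suc k) 0≤b 0≤u = ≤-trans
  (≤-diff (c * u * u * b ^ k)
    (0≤* (0≤* (0≤* (0≤ℕ→ℚ (suc k)) 0≤u) 0≤u) (0≤^ k 0≤b))
    (trans (solve 4 (λ b u c q →
        (b :+ u) :* (b :* q :+ c :* u :* q) := b :* (b :* q) :+ (con 1ℚ :+ c) :* u :* (b :* q) :+ c :* u :* u :* q)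
        refl b u c (b ^ k))
      (cong (λ z → b ^ suc (suc k) + z * u * b ^ suc k + c * u * u * b ^ k) (sym (ℕ→ℚ-suc (suc k))))))
  (*-mono-0≤ˡ (b + u) (0≤+ 0≤b 0≤u) (^-tangent k 0≤b 0≤u))
  where c = ℕ→ℚ (suc k)

-- The lower tail needs the quadratic term: for v = 2τ/((2 + τ)(1 - τ)) one has (1 - τ)(1 + v) = 1 -
-- τ²/(2 + τ), so first order falls short of 1 whenever τ > 0.
^-tangent₂ : ∀ {b u} k → 0ℚ ≤ b → 0ℚ ≤ u →
  b ^ suc (suc k) + ℕ→ℚ (suc (suc k)) * u * b ^ suc k + ½ * ℕ→ℚ (suc (suc k)) * ℕ→ℚ (suc k) * u * u * b ^ k
    ≤ (b + u) ^ suc (suc k)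
^-tangent₂ {b} {u} zero 0≤b 0≤u =
  ≤-reflexive (solve 2 (λ b u → b :* (b :* con 1ℚ) :+ con (ℕ→ℚ 2) :* u :* (b :* con 1ℚ) :+ con ½ :* con (ℕ→ℚ 2) :* con 1ℚ :* u :* u :* con 1ℚ
     := (b :+ u) :* ((b :+ u) :* con 1ℚ)) refl b u)
^-tangent₂ {b} {u} (suc k) 0≤b 0≤u = ≤-trans
  (≤-diff (½ * c₂ * c₁ * u * u * u * b ^ k)
    (0≤* (0≤* (0≤* (0≤* (0≤* (0≤* 0≤½ (0≤ℕ→ℚ (suc (suc k)))) (0≤ℕ→ℚ (suc k))) 0≤u) 0≤u) 0≤u) (0≤^ k 0≤b))
    (subst₂ (λ x y → (b + u) * (b ^ suc (suc k) + x * u * b ^ suc k + ½ * x * c₁ * u * u * b ^ k)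
         ≡ b ^ suc (suc (suc k)) + y * u * b ^ suc (suc k) + ½ * y * x * u * u * b ^ suc k + ½ * x * c₁ * u * u * u * b ^ k)
      (sym (ℕ→ℚ-suc (suc k)))
      (sym (trans (ℕ→ℚ-suc (suc (suc k))) (cong (1ℚ +_) (ℕ→ℚ-suc (suc k)))))
      (solve 4 (λ b u c q → let c₂ = con 1ℚ :+ c ; c₃ = con 1ℚ :+ c₂ in
        (b :+ u) :* (b :* (b :* q) :+ c₂ :* u :* (b :* q) :+ con ½ :* c₂ :* c :* u :* u :* q)
          := b :* (b :* (b :* q)) :+ c₃ :* u :* (b :* (b :* q)) :+ con ½ :* c₃ :* c₂ :* u :* u :* (b :* q)
             :+ con ½ :* c₂ :* c :* u :* u :* u :* q)
        refl b u c₁ (b ^ k))))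
  (*-mono-0≤ˡ (b + u) (0≤+ 0≤b 0≤u) (^-tangent₂ k 0≤b 0≤u))
  where c₁ = ℕ→ℚ (suc k)
        c₂ = ℕ→ℚ (suc (suc k))

^-secant : ∀ {b u} k → 0ℚ ≤ b → 0ℚ ≤ u →
  (b + u) ^ suc k ≤ b ^ suc k + ℕ→ℚ (suc k) * u * (b + u) ^ k
^-secant {b} {u} zero 0≤b 0≤u =
  ≤-reflexive (solve 2 (λ b u → (b :+ u) :* con 1ℚ := b :* con 1ℚ :+ con 1ℚ :* u :* con 1ℚ) refl b u)
^-secant {b} {u} (suc k) 0≤b 0≤u = ≤-trans
  (*-mono-0≤ˡ (b + u) (0≤+ 0≤b 0≤u) (^-secant k 0≤b 0≤u))
  (≤-diff (u * (a ^ suc k - b ^ suc k))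
    (0≤* 0≤u (≤⇒0≤- (^-mono (suc k) 0≤b b≤a)))
    (trans (cong (λ z → b ^ suc (suc k) + z * u * a ^ suc k) (ℕ→ℚ-suc (suc k)))
      (solve 5 (λ b u c p q →
        b :* p :+ (con 1ℚ :+ c) :* u :* ((b :+ u) :* q) :=
        (b :+ u) :* (p :+ c :* u :* q) :+ u :* ((b :+ u) :* q :- p))
        refl b u c (b ^ suc k) (a ^ k))))
  where
  a = b + u
  c = ℕ→ℚ (suc k)
  b≤a : b ≤ a
  b≤a = ≤-diff u 0≤u refl

-- The trapezoid rule overestimates the integral of a convex derivative. In the induction the
-- surplus is `½ * u` times the gap in `^-tangent`.
^-trapezoid : ∀ {b u} k → 0ℚ ≤ b → 0ℚ ≤ u →
  (b + u) ^ suc k ≤ b ^ suc k + ½ * ℕ→ℚ (suc k) * u * ((b + u) ^ k + b ^ k)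
^-trapezoid {b} {u} zero 0≤b 0≤u =
  ≤-reflexive (solve 2 (λ b u → (b :+ u) :* con 1ℚ := b :* con 1ℚ :+ con ½ :* con 1ℚ :* u :* (con 1ℚ :+ con 1ℚ)) refl b u)
^-trapezoid {b} {u} (suc k) 0≤b 0≤u = ≤-trans
  (*-mono-0≤ˡ (b + u) (0≤+ 0≤b 0≤u) (^-trapezoid k 0≤b 0≤u))
  (≤-diff (½ * u * (a ^ suc k - (b ^ suc k + c * u * b ^ k)))
    (0≤* (0≤* 0≤½ 0≤u) (≤⇒0≤- (^-tangent k 0≤b 0≤u)))
    (trans (cong (λ z → b ^ suc (suc k) + ½ * z * u * (a ^ suc k + b ^ suc k)) (ℕ→ℚ-suc (suc k)))
      (solve 5 (λ b u c p q →
        b :* (b :* p) :+ con ½ :* (con 1ℚ :+ c) :* u :* ((b :+ u) :* q :+ b :* p) :=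
        (b :+ u) :* (b :* p :+ con ½ :* c :* u :* (q :+ p)) :+ con ½ :* u :* ((b :+ u) :* q :- (b :* p :+ c :* u :* p)))
        refl b u c (b ^ k) (a ^ k))))
  where
  a = b + u
  c = ℕ→ℚ (suc k)

1/! : ℕ → ℚ
1/! k = (ℤ.+ 1 ℚ./ (k !)) {{k !≢0}}

0≤1/! : ∀ k → 0ℚ ≤ 1/! k
0≤1/! k = 0≤1/ (k !) {{k !≢0}}

-- This cancellation makes x^k / k! the derivative of x^(k+1) / (k+1)!, so that the bounds on powers
-- carry over to terms of the series without any factorial left.
1/!-suc : ∀ k → ℕ→ℚ (suc k) * 1/! (suc k) ≡ 1/! k
1/!-suc k = begin
  c * y                    ≡⟨ *-identityʳ (c * y) ⟨
  c * y * 1ℚ               ≡⟨ cong (c * y *_) (ℕ→ℚ-*-1/ (k !) {{k !≢0}}) ⟨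
  c * y * (f * x)          ≡⟨ solve 4 (λ c y f x → c :* y :* (f :* x) := c :* f :* y :* x) refl c y f x ⟩
  c * f * y * x            ≡⟨ cong (λ z → z * y * x) (ℕ→ℚ-* (suc k) (k !)) ⟨
  ℕ→ℚ (suc k !) * y * x    ≡⟨ cong (_* x) (ℕ→ℚ-*-1/ (suc k !) {{suc k !≢0}}) ⟩
  1ℚ * x                   ≡⟨ *-identityˡ x ⟩
  x                        ∎
  where
  open ≡-Reasoning
  c = ℕ→ℚ (suc k)
  f = ℕ→ℚ (k !)
  x = 1/! k
  y = 1/! (suc k)

-- Definitionally the last summand of `expPartial (suc k) x`, so a partial sum splits by `refl`.
expTerm : ℕ → ℚ → ℚ
expTerm k x = x ^ k * 1/! k

0≤expTerm : ∀ {x} k → 0ℚ ≤ x → 0ℚ ≤ expTerm k x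
0≤expTerm k 0≤x = 0≤* (0≤^ k 0≤x) (0≤1/! k)

0≤expPartial : ∀ {x} N → 0ℚ ≤ x → 0ℚ ≤ expPartial N x
0≤expPartial zero    0≤x = ≤-refl
0≤expPartial (suc N) 0≤x = 0≤+ (0≤expPartial N 0≤x) (0≤expTerm N 0≤x)

expPartial-mono : ∀ {x y} N → 0ℚ ≤ x → x ≤ y → expPartial N x ≤ expPartial N y
expPartial-mono zero    0≤x x≤y = ≤-refl
expPartial-mono (suc N) 0≤x x≤y =
  +-mono-≤ (expPartial-mono N 0≤x x≤y) (*-mono-0≤ʳ (1/! N) (0≤1/! N) (^-mono N 0≤x x≤y))

expPartial-suc : ∀ {x} N → 0ℚ ≤ x → expPartial N x ≤ expPartial (suc N) x
expPartial-suc N 0≤x = ≤-diff (expTerm N _) (0≤expTerm N 0≤x) refl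

expPartial-0 : ∀ N → expPartial N 0ℚ ≤ 1ℚ
expPartial-0 zero          = 0≤1
expPartial-0 (suc zero)    = ≤-refl
expPartial-0 (suc (suc N)) = subst (_≤ 1ℚ)
  (sym (solve 3 (λ e p q → e :+ con 0ℚ :* p :* q := e) refl (expPartial (suc N) 0ℚ) (0ℚ ^ N) (1/! (suc N))))
  (expPartial-0 (suc N))

expTerm-tangent : ∀ {b u} k → 0ℚ ≤ b → 0ℚ ≤ u →
  expTerm (suc k) b + u * expTerm k b ≤ expTerm (suc k) (b + u)
expTerm-tangent {b} {u} k 0≤b 0≤u = subst (_≤ expTerm (suc k) (b + u))
  (trans
    (solve 5 (λ p c u q y → (p :+ c :* u :* q) :* y := p :* y :+ u :* (q :* (c :* y))) refl
      (b ^ suc k) (ℕ→ℚ (suc k)) u (b ^ k) (1/! (suc k)))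
    (cong (λ z → expTerm (suc k) b + u * (b ^ k * z)) (1/!-suc k)))
  (*-mono-0≤ʳ (1/! (suc k)) (0≤1/! (suc k)) (^-tangent k 0≤b 0≤u))

expTerm-tangent₂ : ∀ {b u} k → 0ℚ ≤ b → 0ℚ ≤ u →
  expTerm (suc (suc k)) b + u * expTerm (suc k) b + ½ * u * u * expTerm k b ≤ expTerm (suc (suc k)) (b + u)
expTerm-tangent₂ {b} {u} k 0≤b 0≤u = subst (_≤ expTerm (suc (suc k)) (b + u))
  (trans
    (solve 7 (λ p c d u q r y →
        (p :+ c :* u :* q :+ con ½ :* c :* d :* u :* u :* r) :* y
          := p :* y :+ u :* (q :* (c :* y)) :+ con ½ :* u :* u :* (r :* (d :* (c :* y)))) refl
      (b ^ suc (suc k)) (ℕ→ℚ (suc (suc k))) (ℕ→ℚ (suc k)) u (b ^ suc k) (b ^ k) (1/! (suc (suc k))))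
    (trans
      (cong (λ z → expTerm (suc (suc k)) b + u * (b ^ suc k * z) + ½ * u * u * (b ^ k * (ℕ→ℚ (suc k) * z)))
        (1/!-suc (suc k)))
      (cong (λ z → expTerm (suc (suc k)) b + u * expTerm (suc k) b + ½ * u * u * (b ^ k * z)) (1/!-suc k))))
  (*-mono-0≤ʳ (1/! (suc (suc k))) (0≤1/! (suc (suc k))) (^-tangent₂ k 0≤b 0≤u))

expTerm-secant : ∀ {b u} k → 0ℚ ≤ b → 0ℚ ≤ u →
  expTerm (suc k) (b + u) ≤ expTerm (suc k) b + u * expTerm k (b + u)
expTerm-secant {b} {u} k 0≤b 0≤u = subst (expTerm (suc k) (b + u) ≤_)
  (trans
    (solve 5 (λ p c u q y → (p :+ c :* u :* q) :* y := p :* y :+ u :* (q :* (c :* y))) refl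
      (b ^ suc k) (ℕ→ℚ (suc k)) u ((b + u) ^ k) (1/! (suc k)))
    (cong (λ z → expTerm (suc k) b + u * ((b + u) ^ k * z)) (1/!-suc k)))
  (*-mono-0≤ʳ (1/! (suc k)) (0≤1/! (suc k)) (^-secant k 0≤b 0≤u))

expTerm-trapezoid : ∀ {b u} k → 0ℚ ≤ b → 0ℚ ≤ u →
  expTerm (suc k) (b + u) ≤ expTerm (suc k) b + ½ * u * (expTerm k (b + u) + expTerm k b)
expTerm-trapezoid {b} {u} k 0≤b 0≤u = subst (expTerm (suc k) (b + u) ≤_)
  (trans
    (solve 6 (λ p c u q r y → (p :+ con ½ :* c :* u :* (q :+ r)) :* y
        := p :* y :+ con ½ :* u :* (q :* (c :* y) :+ r :* (c :* y))) refl
      (b ^ suc k) (ℕ→ℚ (suc k)) u ((b + u) ^ k) (b ^ k) (1/! (suc k)))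
    (cong (λ z → expTerm (suc k) b + ½ * u * ((b + u) ^ k * z + b ^ k * z)) (1/!-suc k)))
  (*-mono-0≤ʳ (1/! (suc k)) (0≤1/! (suc k)) (^-trapezoid k 0≤b 0≤u))

-- The truncation orders below are shifted exactly as differentiation shifts them: expPartial N is the derivative of expPartial (suc N).
expPartial-tangent : ∀ {x u} N → 0ℚ ≤ x → 0ℚ ≤ u →
  expPartial (suc N) x + u * expPartial N x ≤ expPartial (suc N) (x + u)
expPartial-tangent {x} {u} zero 0≤x 0≤u =
  ≤-reflexive (solve 1 (λ u → con 1ℚ :+ u :* con 0ℚ := con 1ℚ) refl u)
expPartial-tangent {x} {u} (suc N) 0≤x 0≤u = subst (_≤ expPartial (suc (suc N)) (x + u))
  (solve 5 (λ e u f s t → e :+ u :* f :+ (s :+ u :* t) := e :+ s :+ u :* (f :+ t)) refl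
    (expPartial (suc N) x) u (expPartial N x) (expTerm (suc N) x) (expTerm N x))
  (+-mono-≤ (expPartial-tangent N 0≤x 0≤u) (expTerm-tangent N 0≤x 0≤u))

expPartial-tangent₂ : ∀ {x u} N → 0ℚ ≤ x → 0ℚ ≤ u →
  expPartial (suc (suc N)) x + u * expPartial (suc N) x + ½ * u * u * expPartial N x ≤ expPartial (suc (suc N)) (x + u)
expPartial-tangent₂ {x} {u} zero 0≤x 0≤u = subst (_≤ expPartial 2 (x + u))
  (solve 2 (λ e u → e := e :+ con ½ :* u :* u :* con 0ℚ) refl (expPartial 2 x + u * expPartial 1 x) u)
  (expPartial-tangent 1 0≤x 0≤u)
expPartial-tangent₂ {x} {u} (suc N) 0≤x 0≤u = subst (_≤ expPartial (suc (suc (suc N))) (x + u))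
  (solve 7 (λ e u f g s t v → e :+ u :* f :+ con ½ :* u :* u :* g :+ (s :+ u :* t :+ con ½ :* u :* u :* v)
      := e :+ s :+ u :* (f :+ t) :+ con ½ :* u :* u :* (g :+ v)) refl
    (expPartial (suc (suc N)) x) u (expPartial (suc N) x) (expPartial N x)
    (expTerm (suc (suc N)) x) (expTerm (suc N) x) (expTerm N x))
  (+-mono-≤ (expPartial-tangent₂ N 0≤x 0≤u) (expTerm-tangent₂ N 0≤x 0≤u))

expPartial-secant : ∀ {x u} N → 0ℚ ≤ x → 0ℚ ≤ u →
  expPartial (suc N) (x + u) ≤ expPartial (suc N) x + u * expPartial N (x + u)
expPartial-secant {x} {u} zero 0≤x 0≤u =
  ≤-reflexive (solve 1 (λ u → con 1ℚ := con 1ℚ :+ u :* con 0ℚ) refl u)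
expPartial-secant {x} {u} (suc N) 0≤x 0≤u = subst (expPartial (suc (suc N)) (x + u) ≤_)
  (solve 5 (λ e u f s t → e :+ u :* f :+ (s :+ u :* t) := e :+ s :+ u :* (f :+ t)) refl
    (expPartial (suc N) x) u (expPartial N (x + u)) (expTerm (suc N) x) (expTerm N (x + u)))
  (+-mono-≤ (expPartial-secant N 0≤x 0≤u) (expTerm-secant N 0≤x 0≤u))

expPartial-trapezoid : ∀ {x u} N → 0ℚ ≤ x → 0ℚ ≤ u →
  expPartial (suc N) (x + u) ≤ expPartial (suc N) x + ½ * u * (expPartial N (x + u) + expPartial N x)
expPartial-trapezoid {x} {u} zero 0≤x 0≤u =
  ≤-reflexive (solve 1 (λ u → con 1ℚ := con 1ℚ :+ con ½ :* u :* (con 0ℚ :+ con 0ℚ)) refl u)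
expPartial-trapezoid {x} {u} (suc N) 0≤x 0≤u = subst (expPartial (suc (suc N)) (x + u) ≤_)
  (solve 7 (λ e u f g s t v → e :+ con ½ :* u :* (f :+ g) :+ (s :+ con ½ :* u :* (t :+ v))
      := e :+ s :+ con ½ :* u :* ((f :+ t) :+ (g :+ v))) refl
    (expPartial (suc N) x) u (expPartial N (x + u)) (expPartial N x) (expTerm (suc N) x) (expTerm N (x + u)) (expTerm N x))
  (+-mono-≤ (expPartial-trapezoid N 0≤x 0≤u) (expTerm-trapezoid N 0≤x 0≤u))

-- Pointwise tail estimates

ℕ→ℚ-suc-* : ∀ k u → ℕ→ℚ (suc k) * u ≡ ℕ→ℚ k * u + u
ℕ→ℚ-suc-* k u = trans (cong (_* u) (ℕ→ℚ-suc k))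
  (solve 2 (λ c u → (con 1ℚ :+ c) :* u := c :* u :+ u) refl (ℕ→ℚ k) u)

+-ℕ→ℚ-suc-* : ∀ x k u → x + ℕ→ℚ (suc k) * u ≡ x + ℕ→ℚ k * u + u
+-ℕ→ℚ-suc-* x k u = trans (cong (x +_) (ℕ→ℚ-suc-* k u)) (sym (+-assoc x (ℕ→ℚ k * u) u))

-- Partial-sum form of 1 + u ≤ e^u. The order has to rise: for `N` = 1 the left side is 1 + u, while
-- `expPartial 1` is constantly 1.
[1+u]*expPartial : ∀ {x u} N → 0ℚ ≤ x → 0ℚ ≤ u →
  (1ℚ + u) * expPartial N x ≤ expPartial (suc N) (x + u)
[1+u]*expPartial {x} {u} N 0≤x 0≤u = ≤-trans
  (≤-diff (expTerm N x) (0≤expTerm N 0≤x)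
    (solve 3 (λ u e s → e :+ s :+ u :* e := (con 1ℚ :+ u) :* e :+ s) refl u (expPartial N x) (expTerm N x)))
  (expPartial-tangent N 0≤x 0≤u)

[1+u]^*expPartial : ∀ {x u} K N → 0ℚ ≤ x → 0ℚ ≤ u →
  (1ℚ + u) ^ K * expPartial N x ≤ expPartial (K ℕ.+ N) (x + ℕ→ℚ K * u)
[1+u]^*expPartial {x} {u} zero N 0≤x 0≤u = ≤-reflexive (trans (*-identityˡ _)
  (cong (expPartial N) (solve 2 (λ x u → x := x :+ con 0ℚ :* u) refl x u)))
[1+u]^*expPartial {x} {u} (suc K) N 0≤x 0≤u = begin
  (1ℚ + u) * (1ℚ + u) ^ K * expPartial N x             ≡⟨ *-assoc (1ℚ + u) _ _ ⟩
  (1ℚ + u) * ((1ℚ + u) ^ K * expPartial N x)           ≤⟨ *-mono-0≤ˡ (1ℚ + u) (0≤+ 0≤1 0≤u) ([1+u]^*expPartial K N 0≤x 0≤u) ⟩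
  (1ℚ + u) * expPartial (K ℕ.+ N) (x + ℕ→ℚ K * u)      ≤⟨ [1+u]*expPartial (K ℕ.+ N) (0≤+ 0≤x (0≤* (0≤ℕ→ℚ K) 0≤u)) 0≤u ⟩
  expPartial (suc K ℕ.+ N) (x + ℕ→ℚ K * u + u)         ≡⟨ cong (expPartial (suc K ℕ.+ N)) (sym (+-ℕ→ℚ-suc-* x K u)) ⟩
  expPartial (suc K ℕ.+ N) (x + ℕ→ℚ (suc K) * u)       ∎
  where open ≤-Reasoning

-- Here the order stays fixed: the secant bound has the lower order on its larger side, where it may
-- be raised for free.
[1-u]*expPartial : ∀ {x u} N → 0ℚ ≤ x → 0ℚ ≤ u → (1ℚ - u) * expPartial N (x + u) ≤ expPartial N x
[1-u]*expPartial {x} {u} zero    0≤x 0≤u = ≤-reflexive (*-zeroʳ (1ℚ - u))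
[1-u]*expPartial {x} {u} (suc N) 0≤x 0≤u =
  ≤-diff (e + u * a - a) (≤⇒0≤- (≤-trans (expPartial-secant N 0≤x 0≤u)
      (+-monoʳ-≤ e (*-mono-0≤ˡ u 0≤u (expPartial-suc N (0≤+ 0≤x 0≤u))))))
    (solve 3 (λ e u a → e := (con 1ℚ :- u) :* a :+ (e :+ u :* a :- a)) refl e u a)
  where
  a = expPartial (suc N) (x + u)
  e = expPartial (suc N) x

[1-u]^*expPartial : ∀ {u} K N → 0ℚ ≤ u → u ≤ 1ℚ → (1ℚ - u) ^ K * expPartial N (ℕ→ℚ K * u) ≤ 1ℚ
[1-u]^*expPartial {u} zero N 0≤u u≤1 = subst (_≤ 1ℚ)
  (sym (trans (*-identityˡ _) (cong (expPartial N) (*-zeroˡ u)))) (expPartial-0 N)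
[1-u]^*expPartial {u} (suc K) N 0≤u u≤1 = begin
  (1ℚ - u) * (1ℚ - u) ^ K * expPartial N (ℕ→ℚ (suc K) * u)    ≡⟨ cong (λ z → (1ℚ - u) * (1ℚ - u) ^ K * expPartial N z) (ℕ→ℚ-suc-* K u) ⟩
  (1ℚ - u) * (1ℚ - u) ^ K * expPartial N (ℕ→ℚ K * u + u)      ≡⟨ solve 3 (λ s p e → s :* p :* e := p :* (s :* e)) refl (1ℚ - u) ((1ℚ - u) ^ K) (expPartial N (ℕ→ℚ K * u + u)) ⟩
  (1ℚ - u) ^ K * ((1ℚ - u) * expPartial N (ℕ→ℚ K * u + u))    ≤⟨ *-mono-0≤ˡ _ (0≤^ K (≤⇒0≤- u≤1)) ([1-u]*expPartial N (0≤* (0≤ℕ→ℚ K) 0≤u) 0≤u) ⟩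
  (1ℚ - u) ^ K * expPartial N (ℕ→ℚ K * u)                     ≤⟨ [1-u]^*expPartial K N 0≤u u≤1 ⟩
  1ℚ                                                          ∎
  where open ≤-Reasoning

-- `q` is 1/(2 + τ), given as a variable with one equation. Each identity then becomes a ring
-- identity once `q * (1ℚ + 1ℚ + τ)` has been traded for 1; `r` below plays the same part for 1/(1 -
-- τ).
module _ {τ q : ℚ} (0≤τ : 0ℚ ≤ τ) (0<q : 0ℚ < q) (q[2+τ]≡1 : q * (1ℚ + 1ℚ + τ) ≡ 1ℚ) where

  private
    0≤q : 0ℚ ≤ q
    0≤q = <⇒≤ 0<q

    0≤2τq : 0ℚ ≤ (1ℚ + 1ℚ) * τ * q
    0≤2τq = 0≤* (0≤* (0≤+ 0≤1 0≤1) 0≤τ) 0≤q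

  -- e^y ≤ (1 + y/2) / (1 - y/2), which is 1 + τ at y = 2τ/(2 + τ)
  expPartial-+-2τ/[2+τ] : ∀ {x} N → 0ℚ ≤ x →
    expPartial (suc N) (x + (1ℚ + 1ℚ) * τ * q) ≤ (1ℚ + τ) * expPartial (suc N) x
  -- The cancelled factor 2q is 1 - y/2, and (1 + τ) · 2q is 1 + y/2; both follow from q (2 + τ) =
  -- 1. The trapezoid bound a ≤ b + (y/2)(a + b) is therefore the claim after multiplication by 2q.
  expPartial-+-2τ/[2+τ] {x} N 0≤x = *-cancel-0< ((1ℚ + 1ℚ) * q)
    (0<* (positive⁻¹ (1ℚ + 1ℚ)) 0<q)
    (≤-diff (b + ½ * y * (a + b) - a)
      (≤⇒0≤- (≤-trans (expPartial-trapezoid N 0≤x 0≤2τq)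
        (+-monoʳ-≤ b (*-mono-0≤ˡ (½ * y) (0≤* 0≤½ 0≤2τq)
          (+-mono-≤ (expPartial-suc N (0≤+ 0≤x 0≤2τq)) (expPartial-suc N 0≤x))))))
      (trans
        (solve 4 (λ τ q a b → let one = con 1ℚ ; two = one :+ one ; y = two :* τ :* q ; e = q :* (two :+ τ) in
          two :* q :* ((one :+ τ) :* b) := two :* q :* a :+ (e :* b :+ con ½ :* y :* (a :+ b) :- e :* a)) refl τ q a b)
        (trans (cong (λ e → (1ℚ + 1ℚ) * q * a + (e * b + ½ * y * (a + b) - e * a)) q[2+τ]≡1)
          (solve 4 (λ c y a b → let one = con 1ℚ in
             c :* a :+ (one :* b :+ con ½ :* y :* (a :+ b) :- one :* a) := c :* a :+ (b :+ con ½ :* y :* (a :+ b) :- a))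
            refl ((1ℚ + 1ℚ) * q) y a b))))
    where
    y = (1ℚ + 1ℚ) * τ * q
    a = expPartial (suc N) (x + y)
    b = expPartial (suc N) x

  -- The bound is uniform in the truncation order, so it absorbs whatever order the factors 1 + u
  -- have built up.
  expPartial≤[1+τ]^ : ∀ e N → expPartial (suc N) (ℕ→ℚ e * ((1ℚ + 1ℚ) * τ * q)) ≤ (1ℚ + τ) ^ e
  expPartial≤[1+τ]^ zero N = subst (_≤ 1ℚ) (cong (expPartial (suc N)) (sym (*-zeroˡ ((1ℚ + 1ℚ) * τ * q)))) (expPartial-0 (suc N))
  expPartial≤[1+τ]^ (suc e) N = begin
    expPartial (suc N) (ℕ→ℚ (suc e) * y)        ≡⟨ cong (expPartial (suc N)) (ℕ→ℚ-suc-* e y) ⟩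
    expPartial (suc N) (ℕ→ℚ e * y + y)          ≤⟨ expPartial-+-2τ/[2+τ] N (0≤* (0≤ℕ→ℚ e) 0≤2τq) ⟩
    (1ℚ + τ) * expPartial (suc N) (ℕ→ℚ e * y)   ≤⟨ *-mono-0≤ˡ (1ℚ + τ) (0≤+ 0≤1 0≤τ) (expPartial≤[1+τ]^ e N) ⟩
    (1ℚ + τ) * (1ℚ + τ) ^ e                     ∎
    where
    open ≤-Reasoning
    y = (1ℚ + 1ℚ) * τ * q

  module _ {p : ℚ} (0≤p : 0ℚ ≤ p) (p≤1 : p ≤ 1ℚ) (K e N : ℕ) where

    private
      -- For p = |B|/n and K = d|A|, `m` is the mean μ and `x` the exponent τ²μ/(2 + τ); `e` stands
      -- for a value of the edge count.
      m x : ℚ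
      m = ℕ→ℚ K * p
      x = τ * τ * m * q

      0≤m : 0ℚ ≤ m
      0≤m = 0≤* (0≤ℕ→ℚ K) 0≤p

      0≤x : 0ℚ ≤ x
      0≤x = 0≤* (0≤* (0≤* 0≤τ 0≤τ) 0≤m) 0≤q

      p*u≤1 : ∀ {u} → 0ℚ ≤ u → u ≤ 1ℚ → p * u ≤ 1ℚ
      p*u≤1 0≤u u≤1 = *-mono-0≤ 0≤p 0≤1 p≤1 u≤1

      mean-1-u : ∀ u → 1ℚ - p + p * (1ℚ - u) ≡ 1ℚ - p * u
      mean-1-u u = solve 2 (λ p u → con 1ℚ :- p :+ p :* (con 1ℚ :- u) := con 1ℚ :- p :* u) refl p u

    -- The factor (1 + pτ)^K adds mτ to the argument of the series, and (1 + τ)^e has room for e ·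
    -- 2τq. Since x + mτ equals (m + τm) · 2τq exactly, the hypothesis on `e` is just what makes it
    -- fit.
    upper-pointwise : m + τ * m ≤ ℕ→ℚ e → (1ℚ - p + p * (1ℚ + τ)) ^ K * expPartial N x ≤ (1ℚ + τ) ^ e
    upper-pointwise h = begin
      (1ℚ - p + p * (1ℚ + τ)) ^ K * expPartial N x                ≡⟨ cong (λ z → z ^ K * expPartial N x) (solve 2 (λ p τ → con 1ℚ :- p :+ p :* (con 1ℚ :+ τ) := con 1ℚ :+ p :* τ) refl p τ) ⟩
      (1ℚ + p * τ) ^ K * expPartial N x                           ≤⟨ [1+u]^*expPartial K N 0≤x 0≤pτ ⟩
      expPartial (K ℕ.+ N) (x + ℕ→ℚ K * (p * τ))                  ≤⟨ expPartial-suc (K ℕ.+ N) 0≤z ⟩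
      expPartial (suc (K ℕ.+ N)) (x + ℕ→ℚ K * (p * τ))            ≤⟨ expPartial-mono (suc (K ℕ.+ N)) 0≤z z≤ey ⟩
      expPartial (suc (K ℕ.+ N)) (ℕ→ℚ e * ((1ℚ + 1ℚ) * τ * q))    ≤⟨ expPartial≤[1+τ]^ e (K ℕ.+ N) ⟩
      (1ℚ + τ) ^ e                                                ∎
      where
      open ≤-Reasoning
      0≤pτ = 0≤* 0≤p 0≤τ
      0≤z = 0≤+ 0≤x (0≤* (0≤ℕ→ℚ K) 0≤pτ)
      z≤ey : x + ℕ→ℚ K * (p * τ) ≤ ℕ→ℚ e * ((1ℚ + 1ℚ) * τ * q)
      z≤ey = subst (_≤ ℕ→ℚ e * ((1ℚ + 1ℚ) * τ * q))
        (trans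
          (solve 4 (λ κ p τ q → let one = con 1ℚ in
            (κ :* p :+ τ :* (κ :* p)) :* ((one :+ one) :* τ :* q)
              := τ :* τ :* (κ :* p) :* q :+ κ :* (p :* τ) :* (q :* (one :+ one :+ τ))) refl (ℕ→ℚ K) p τ q)
          (trans (cong (λ z → x + ℕ→ℚ K * (p * τ) * z) q[2+τ]≡1) (cong (x +_) (*-identityʳ _))))
        (*-mono-0≤ʳ _ 0≤2τq h)

    module _ (τ<1 : τ < 1ℚ) {r : ℚ} (0≤r : 0ℚ ≤ r) (r[1-τ]≡1 : r * (1ℚ - τ) ≡ 1ℚ) where

      private
        t v : ℚ
        t = 1ℚ - τ
        v = (1ℚ + 1ℚ) * τ * q * r

        0≤t : 0ℚ ≤ t
        0≤t = ≤⇒0≤- (<⇒≤ τ<1)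

        0≤v : 0ℚ ≤ v
        0≤v = 0≤* 0≤2τq 0≤r

      -- 1/(1 - τ) ≤ 1 + v + v²/2 for v = 2τ/((2 + τ)(1 - τ))
      1≤[1-τ][1+v+v²/2] : 1ℚ ≤ t * (1ℚ + v + ½ * v * v)
      -- The surplus is τq(v - τ). Expanding τ as τ · q(2 + τ) · r(1 - τ) gives v - τ = τqr(2 - (2 +
      -- τ)(1 - τ)) = τqr(τ + τ²), visibly nonnegative.
      1≤[1-τ][1+v+v²/2] = ≤-diff (τ * q * (τ * q * r * (τ + τ * τ)))
        (0≤* (0≤* 0≤τ 0≤q) (0≤* (0≤* (0≤* 0≤τ 0≤q) 0≤r) (0≤+ 0≤τ (0≤* 0≤τ 0≤τ))))
        (begin
        t * (1ℚ + v + ½ * v * v)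
          ≡⟨ solve 3 (λ τ q r → let one = con 1ℚ ; two = one :+ one ; t = one :- τ ; v = two :* τ :* q :* r in
               t :* (one :+ v :+ con ½ :* v :* v) := t :+ (one :+ con ½ :* v) :* (two :* τ :* q) :* (r :* t)) refl τ q r ⟩
        t + (1ℚ + ½ * v) * ((1ℚ + 1ℚ) * τ * q) * (r * t)
          ≡⟨ cong (λ z → t + (1ℚ + ½ * v) * ((1ℚ + 1ℚ) * τ * q) * z) r[1-τ]≡1 ⟩
        t + (1ℚ + ½ * v) * ((1ℚ + 1ℚ) * τ * q) * 1ℚ
          ≡⟨ solve 3 (λ τ q v → let one = con 1ℚ ; two = one :+ one in
               (one :- τ) :+ (one :+ con ½ :* v) :* (two :* τ :* q) :* one := one :- τ :* one :+ τ :* q :* (two :+ v)) refl τ q v ⟩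
        1ℚ - τ * 1ℚ + τ * q * (1ℚ + 1ℚ + v)
          ≡⟨ cong (λ z → 1ℚ - τ * z + τ * q * (1ℚ + 1ℚ + v)) q[2+τ]≡1 ⟨
        1ℚ - τ * (q * (1ℚ + 1ℚ + τ)) + τ * q * (1ℚ + 1ℚ + v)
          ≡⟨ solve 3 (λ τ q v → let one = con 1ℚ ; two = one :+ one in
               one :- τ :* (q :* (two :+ τ)) :+ τ :* q :* (two :+ v) := one :+ τ :* q :* (v :- τ :* (one :* one))) refl τ q v ⟩
        1ℚ + τ * q * (v - τ * (1ℚ * 1ℚ))
          ≡⟨ cong₂ (λ y z → 1ℚ + τ * q * (v - τ * (y * z))) q[2+τ]≡1 r[1-τ]≡1 ⟨
        1ℚ + τ * q * (v - τ * (q * (1ℚ + 1ℚ + τ) * (r * t)))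
          ≡⟨ solve 3 (λ τ q r → let one = con 1ℚ ; two = one :+ one ; t = one :- τ ; v = two :* τ :* q :* r in
               one :+ τ :* q :* (v :- τ :* (q :* (two :+ τ) :* (r :* t))) := one :+ τ :* q :* (τ :* q :* r :* (τ :+ τ :* τ))) refl τ q r ⟩
        1ℚ + τ * q * (τ * q * r * (τ + τ * τ)) ∎)
        where open ≡-Reasoning

      -- `expPartial-tangent₂` involves three successive orders, one per derivative. Each is at
      -- least the value at order `M`, which can then be factored out; the price is an order raised
      -- by two.
      expPartial≤[1-τ]* : ∀ {z} M → 0ℚ ≤ z → expPartial M z ≤ t * expPartial (suc (suc M)) (z + v)
      expPartial≤[1-τ]* {z} M 0≤z = begin
        a                                             ≡⟨ *-identityˡ a ⟨
        1ℚ * a                                        ≤⟨ *-mono-0≤ʳ a (0≤expPartial M 0≤z) 1≤[1-τ][1+v+v²/2] ⟩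
        t * (1ℚ + v + ½ * v * v) * a                  ≡⟨ solve 3 (λ t v a → t :* (con 1ℚ :+ v :+ con ½ :* v :* v) :* a := t :* (a :+ v :* a :+ con ½ :* v :* v :* a)) refl t v a ⟩
        t * (a + v * a + ½ * v * v * a)               ≤⟨ *-mono-0≤ˡ t 0≤t (+-mono-≤ (+-mono-≤ (≤-trans a≤b (expPartial-suc (suc M) 0≤z)) (*-mono-0≤ˡ v 0≤v a≤b)) ≤-refl) ⟩
        t * (expPartial (suc (suc M)) z + v * expPartial (suc M) z + ½ * v * v * a)  ≤⟨ *-mono-0≤ˡ t 0≤t (expPartial-tangent₂ M 0≤z 0≤v) ⟩
        t * expPartial (suc (suc M)) (z + v)          ∎
        where
        open ≤-Reasoning
        a = expPartial M z
        a≤b = expPartial-suc M 0≤z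

      expPartial≤[1-τ]^* : ∀ {z} k M → 0ℚ ≤ z → expPartial M z ≤ t ^ k * expPartial (k ℕ.* 2 ℕ.+ M) (z + ℕ→ℚ k * v)
      expPartial≤[1-τ]^* {z} zero M 0≤z = ≤-reflexive (sym (trans (*-identityˡ _)
        (cong (expPartial M) (solve 2 (λ z v → z :+ con 0ℚ :* v := z) refl z v))))
      expPartial≤[1-τ]^* {z} (suc k) M 0≤z = begin
        expPartial M z                              ≤⟨ expPartial≤[1-τ]^* k M 0≤z ⟩
        t ^ k * expPartial M′ z′                    ≤⟨ *-mono-0≤ˡ (t ^ k) (0≤^ k 0≤t) (expPartial≤[1-τ]* M′ (0≤+ 0≤z (0≤* (0≤ℕ→ℚ k) 0≤v))) ⟩
        t ^ k * (t * expPartial (suc (suc M′)) (z′ + v))  ≡⟨ solve 3 (λ p t e → p :* (t :* e) := t :* p :* e) refl (t ^ k) t (expPartial (suc (suc M′)) (z′ + v)) ⟩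
        t * t ^ k * expPartial (suc (suc M′)) (z′ + v)    ≡⟨ cong (λ y → t * t ^ k * expPartial (suc (suc M′)) y) (+-ℕ→ℚ-suc-* z k v) ⟨
        t * t ^ k * expPartial (suc (suc M′)) (z + ℕ→ℚ (suc k) * v)    ∎
        where
        open ≤-Reasoning
        M′ = k ℕ.* 2 ℕ.+ M
        z′ = z + ℕ→ℚ k * v

      -- Extracting (1 - τ)^e raises the argument from x to x + e v, while (1 - pτ)^K can absorb up
      -- to K p τ = mτ. From e ≤ (1 - τ)m follows e v ≤ (1 - τ)m v = 2τqm, and x + 2τqm is exactly
      -- mτ.
      lower-pointwise : ℕ→ℚ e + τ * m ≤ m → (1ℚ - p + p * (1ℚ - τ)) ^ K * expPartial N x ≤ (1ℚ - τ) ^ e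
      lower-pointwise h = begin
        (1ℚ - p + p * (1ℚ - τ)) ^ K * expPartial N x          ≡⟨ cong (λ z → z ^ K * expPartial N x) (mean-1-u τ) ⟩
        s ^ K * expPartial N x                                ≤⟨ *-mono-0≤ˡ (s ^ K) 0≤s^K (expPartial≤[1-τ]^* e N 0≤x) ⟩
        s ^ K * (t ^ e * expPartial N′ (x + ℕ→ℚ e * v))       ≤⟨ *-mono-0≤ˡ (s ^ K) 0≤s^K (*-mono-0≤ˡ (t ^ e) (0≤^ e 0≤t) (expPartial-mono N′ (0≤+ 0≤x (0≤* (0≤ℕ→ℚ e) 0≤v)) z≤Kpτ)) ⟩
        s ^ K * (t ^ e * expPartial N′ (ℕ→ℚ K * (p * τ)))     ≡⟨ solve 3 (λ a b c → a :* (b :* c) := b :* (a :* c)) refl (s ^ K) (t ^ e) (expPartial N′ (ℕ→ℚ K * (p * τ))) ⟩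
        t ^ e * (s ^ K * expPartial N′ (ℕ→ℚ K * (p * τ)))     ≤⟨ *-mono-0≤ˡ (t ^ e) (0≤^ e 0≤t) ([1-u]^*expPartial K N′ (0≤* 0≤p 0≤τ) pτ≤1) ⟩
        t ^ e * 1ℚ                                            ≡⟨ *-identityʳ (t ^ e) ⟩
        t ^ e                                                 ∎
        where
        open ≤-Reasoning
        s = 1ℚ - p * τ
        N′ = e ℕ.* 2 ℕ.+ N
        pτ≤1 = p*u≤1 0≤τ (<⇒≤ τ<1)
        0≤s^K = 0≤^ K (≤⇒0≤- pτ≤1)
        z≤Kpτ : x + ℕ→ℚ e * v ≤ ℕ→ℚ K * (p * τ)
        z≤Kpτ = ≤-diff ((m - (ℕ→ℚ e + τ * m)) * v) (0≤* (≤⇒0≤- h) 0≤v)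
          (trans
            (trans (sym (*-identityʳ _)) (cong (ℕ→ℚ K * (p * τ) *_) (sym q[2+τ]≡1)))
            (trans
              (solve 4 (λ κ p τ q → let one = con 1ℚ ; two = one :+ one ; m = κ :* p in
                κ :* (p :* τ) :* (q :* (two :+ τ)) := τ :* τ :* m :* q :+ two :* τ :* q :* m :* one) refl (ℕ→ℚ K) p τ q)
              (trans (cong (λ z → x + (1ℚ + 1ℚ) * τ * q * m * z) (sym r[1-τ]≡1))
                (solve 6 (λ κ p τ q r c → let one = con 1ℚ ; two = one :+ one ; m = κ :* p ; v = two :* τ :* q :* r ; x = τ :* τ :* m :* q in
                  x :+ two :* τ :* q :* m :* (r :* (one :- τ)) := x :+ c :* v :+ (m :- (c :+ τ :* m)) :* v)
                  refl (ℕ→ℚ K) p τ q r (ℕ→ℚ e)))))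

    -- For τ ≥ 1 the lower tail forces e = 0, and any fixed base in (0, 1) serves.
    lower-pointwise′ : 1ℚ ≤ τ → ℕ→ℚ e + τ * m ≤ m → (1ℚ - p + p * ½) ^ K * expPartial N x ≤ ½ ^ e
    lower-pointwise′ 1≤τ h = begin
      (1ℚ - p + p * ½) ^ K * expPartial N x                   ≡⟨ cong (λ z → z ^ K * expPartial N x) (mean-1-u ½) ⟩
      (1ℚ - p * ½) ^ K * expPartial N x                       ≤⟨ *-mono-0≤ˡ _ (0≤^ K (≤⇒0≤- p½≤1)) (expPartial-mono N 0≤x x≤) ⟩
      (1ℚ - p * ½) ^ K * expPartial N (ℕ→ℚ K * (p * ½))       ≤⟨ [1-u]^*expPartial K N (0≤* 0≤p 0≤½) p½≤1 ⟩
      1ℚ                                                      ≡⟨ cong (½ ^_) (e≡0 e ιe≤0) ⟨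
      ½ ^ e                                                   ∎
      where
      open ≤-Reasoning
      p½≤1 : p * ½ ≤ 1ℚ
      p½≤1 = p*u≤1 0≤½ (≤-diff ½ 0≤½ refl)
      τm≤m : τ * m ≤ m
      τm≤m = ≤-trans (≤-diff (ℕ→ℚ e) (0≤ℕ→ℚ e) (+-comm (ℕ→ℚ e) (τ * m))) h
      x≤ : x ≤ ℕ→ℚ K * (p * ½)
      -- Only τ = 1 or m = 0 survive here, so x is m/3 or 0 and m/2 is enough. Algebraically,
      -- (m/2)(2 + τ) - τ²m = (m - τm)(1 + τ) + τm/2.
      x≤ = ≤-diff (((m - τ * m) * (1ℚ + τ) + ½ * (τ * m)) * q)
        (0≤* (0≤+ (0≤* (≤⇒0≤- τm≤m) (0≤+ 0≤1 0≤τ)) (0≤* 0≤½ (0≤* 0≤τ 0≤m))) 0≤q)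
        (trans
          (trans (sym (*-identityʳ _)) (cong (ℕ→ℚ K * (p * ½) *_) (sym q[2+τ]≡1)))
          (solve 4 (λ κ p τ q → let one = con 1ℚ ; two = one :+ one ; m = κ :* p in
             κ :* (p :* con ½) :* (q :* (two :+ τ)) := τ :* τ :* m :* q :+ ((m :- τ :* m) :* (one :+ τ) :+ con ½ :* (τ :* m)) :* q)
             refl (ℕ→ℚ K) p τ q))
      ιe≤0 : ℕ→ℚ e ≤ 0ℚ
      ιe≤0 = ≤-diff ((m - (ℕ→ℚ e + τ * m)) + (τ - 1ℚ) * m) (0≤+ (≤⇒0≤- h) (0≤* (≤⇒0≤- 1≤τ) 0≤m))
        (solve 3 (λ c m τ → con 0ℚ := c :+ ((m :- (c :+ τ :* m)) :+ (τ :- con 1ℚ) :* m)) refl (ℕ→ℚ e) m τ)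
      e≡0 : ∀ e → ℕ→ℚ e ≤ 0ℚ → e ≡ 0
      e≡0 zero    _ = refl
      e≡0 (suc e) h = ⊥-elim (<-irrefl refl (<-≤-trans (ℕ→ℚ-pos e) h))

-- Sampling without replacement

-- The factor `ℕ→ℚ b` annihilates the junk value at `pred 0`, so the two functions have to be
-- compared only at genuine predecessors.
ℕ→ℚ-*-cong : ∀ b {f g : ℕ → ℚ} → (∀ b′ → b ≡ suc b′ → f b′ ≡ g b′) →
  ℕ→ℚ b * f (pred b) ≡ ℕ→ℚ b * g (pred b)
ℕ→ℚ-*-cong zero    {f} {g} eq = trans (*-zeroˡ (f 0)) (sym (*-zeroˡ (g 0)))
ℕ→ℚ-*-cong (suc b) eq = cong (ℕ→ℚ (suc b) *_) (eq b refl)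

ℕ→ℚ-*-mono : ∀ b {f g : ℕ → ℚ} → (∀ b′ → b ≡ suc b′ → f b′ ≤ g b′) →
  ℕ→ℚ b * f (pred b) ≤ ℕ→ℚ b * g (pred b)
ℕ→ℚ-*-mono zero    {f} {g} le = ≤-reflexive (trans (*-zeroˡ (f 0)) (sym (*-zeroˡ (g 0))))
ℕ→ℚ-*-mono (suc b) le = *-mono-0≤ˡ (ℕ→ℚ (suc b)) (0≤ℕ→ℚ (suc b)) (le b refl)

-- Truncated and rational subtraction of 1 differ only at 0, where the outer factor vanishes.
ℕ→ℚ-*-pred : ∀ b z → ℕ→ℚ b * (ℕ→ℚ (pred b) + z) ≡ ℕ→ℚ b * (ℕ→ℚ b - 1ℚ + z)
ℕ→ℚ-*-pred zero    z = trans (*-zeroˡ (0ℚ + z)) (sym (*-zeroˡ (0ℚ - 1ℚ + z)))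
ℕ→ℚ-*-pred (suc b) z = cong (λ y → ℕ→ℚ (suc b) * (y + z))
  (trans (solve 1 (λ b → b := con 1ℚ :+ b :- con 1ℚ) refl (ℕ→ℚ b)) (cong (_- 1ℚ) (sym (ℕ→ℚ-suc b))))

size+size∁ : ∀ {m} (A : Subset m) → size A ℕ.+ size (∁ A) ≡ m
size+size∁ []          = refl
size+size∁ (true ∷ A)  = cong suc (size+size∁ A)
size+size∁ (false ∷ A) = trans (ℕP.+-suc (size A) (size (∁ A))) (cong suc (size+size∁ A))

-- For 0 ≤ x ≤ W and n = N + 1, the map x ↦ x (W - x)^k lies below its tangent line at the mean W/n (scaled so that no division occurs).
tangent-at-mean : ∀ {x W} N k → k ℕ.≤ N → 0ℚ ≤ x → x ≤ W →
  ℕ→ℚ N * (ℕ→ℚ (suc N) * x) * (ℕ→ℚ (suc N) * (W - x)) ^ k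
    ≤ (ℕ→ℚ N * W) ^ k * (ℕ→ℚ N * W + (ℕ→ℚ N - ℕ→ℚ k) * (ℕ→ℚ (suc N) * x - W))
tangent-at-mean {x} {W} N zero k≤N 0≤x x≤W = ≤-reflexive
  (solve 4 (λ x W N n → N :* (n :* x) :* con 1ℚ := con 1ℚ :* (N :* W :+ (N :- con 0ℚ) :* (n :* x :- W)))
    refl x W (ℕ→ℚ N) (ℕ→ℚ (suc N)))
tangent-at-mean {x} {W} N (suc k) k<N 0≤x x≤W = begin
  N′ * (n′ * x) * (n′ * (W - x) * (n′ * (W - x)) ^ k)
    ≡⟨ solve 3 (λ a b c → a :* (b :* c) := b :* (a :* c)) refl (N′ * (n′ * x)) (n′ * (W - x)) ((n′ * (W - x)) ^ k) ⟩
  n′ * (W - x) * (N′ * (n′ * x) * (n′ * (W - x)) ^ k)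
    ≤⟨ *-mono-0≤ˡ _ (0≤* (0≤ℕ→ℚ (suc N)) (≤⇒0≤- x≤W)) (tangent-at-mean N k k≤N 0≤x x≤W) ⟩
  n′ * (W - x) * (Q * (N′ * W + (N′ - k′) * (n′ * x - W)))
    -- The multiplier n(W - x) equals NW - z. Times the old tangent line it has the linear part of
    -- the new one, and what is lost is Q (N - k) z², nonnegative because k ≤ N.
    ≤⟨ ≤-diff (Q * ((N′ - k′) * (z * z))) (0≤* 0≤Q (0≤* (≤⇒0≤- (ℕ→ℚ-mono k≤N)) 0≤z²)) diff ⟩
  N′ * W * Q * (N′ * W + (N′ - ℕ→ℚ (suc k)) * (n′ * x - W)) ∎
  where
  open ≤-Reasoning
  N′ = ℕ→ℚ N
  n′ = ℕ→ℚ (suc N)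
  k′ = ℕ→ℚ k
  Q = (N′ * W) ^ k
  z = n′ * x - W
  k≤N : k ℕ.≤ N
  k≤N = ℕP.<⇒≤ k<N
  0≤Q : 0ℚ ≤ Q
  0≤Q = 0≤^ k (0≤* (0≤ℕ→ℚ N) (≤-trans 0≤x x≤W))
  0≤z² : 0ℚ ≤ z * z
  0≤z² = 0≤square z
    where
    0≤square : ∀ y → 0ℚ ≤ y * y
    0≤square y with ≤-total 0ℚ y
    ... | inj₁ 0≤y = 0≤* 0≤y 0≤y
    ... | inj₂ y≤0 = subst (0ℚ ≤_) (solve 1 (λ y → (:- y) :* (:- y) := y :* y) refl y) (0≤* 0≤-y 0≤-y)
      where
      0≤-y : 0ℚ ≤ - y
      0≤-y = neg-antimono-≤ y≤0
  diff : N′ * W * Q * (N′ * W + (N′ - ℕ→ℚ (suc k)) * (n′ * x - W))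
       ≡ n′ * (W - x) * (Q * (N′ * W + (N′ - k′) * (n′ * x - W))) + Q * ((N′ - k′) * (z * z))
  diff = subst₂ (λ n′ k⁺ → N′ * W * Q * (N′ * W + (N′ - k⁺) * (n′ * x - W))
       ≡ n′ * (W - x) * (Q * (N′ * W + (N′ - k′) * (n′ * x - W))) + Q * ((N′ - k′) * ((n′ * x - W) * (n′ * x - W))))
     (sym (ℕ→ℚ-suc N)) (sym (ℕ→ℚ-suc k))
     (solve 5 (λ x W N k Q → let n = con 1ℚ :+ N ; z = n :* x :- W in
        N :* W :* Q :* (N :* W :+ (N :- (con 1ℚ :+ k)) :* z)
          := n :* (W :- x) :* (Q :* (N :* W :+ (N :- k) :* z)) :+ Q :* ((N :- k) :* (z :* z))) refl x W N′ k′ Q)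

module _ (t : ℚ) where

  -- Drawing without replacement from b elements of weight t and c of weight 1:
  -- the total weight of all injective sequences of length k.  When b = 0 the junk value pred b is multiplied by 0.
  draws : ℕ → ℕ → ℕ → ℚ
  draws zero    b c = 1ℚ
  draws (suc k) b c = ℕ→ℚ b * (t * draws k (pred b) c) + ℕ→ℚ c * draws k b (pred c)

  -- The same when only the draws at the positions in A are weighted.
  drawsAt : ∀ {m} → Subset m → ℕ → ℕ → ℚ
  drawsAt []      b c = 1ℚ
  drawsAt (a ∷ A) b c = ℕ→ℚ b * ((if a then t else 1ℚ) * drawsAt A (pred b) c) + ℕ→ℚ c * drawsAt A b (pred c)

  -- Exchangeability: an unweighted draw made before `k` weighted ones may be moved behind them,
  -- where b + c - k elements remain to choose from.
  draws-extend : ∀ k b c →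
    ℕ→ℚ b * draws k (pred b) c + ℕ→ℚ c * draws k b (pred c) ≡ (ℕ→ℚ b + ℕ→ℚ c - ℕ→ℚ k) * draws k b c
  draws-extend zero    b c = solve 2 (λ b c → b :* con 1ℚ :+ c :* con 1ℚ := (b :+ c :- con 0ℚ) :* con 1ℚ) refl (ℕ→ℚ b) (ℕ→ℚ c)
  draws-extend (suc k) b c = begin
    β * (β⁻ * (t * p) + γ * q) + γ * (β * (t * q) + γ⁻ * r)
      ≡⟨ solve 8 (λ β β⁻ γ γ⁻ t p q r →
           β :* (β⁻ :* (t :* p) :+ γ :* q) :+ γ :* (β :* (t :* q) :+ γ⁻ :* r)
             := β :* t :* (β⁻ :* p :+ γ :* q) :+ γ :* (β :* q :+ γ⁻ :* r)) refl β β⁻ γ γ⁻ t p q r ⟩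
    β * t * (β⁻ * p + γ * q) + γ * (β * q + γ⁻ * r)
      ≡⟨ cong₂ (λ y z → β * t * y + γ * z) (draws-extend k (pred b) c) (draws-extend k b (pred c)) ⟩
    β * t * ((β⁻ + γ - κ) * u) + γ * ((β + γ⁻ - κ) * v)
      ≡⟨ solve 8 (λ β β⁻ γ γ⁻ t κ u v →
           β :* t :* ((β⁻ :+ γ :- κ) :* u) :+ γ :* ((β :+ γ⁻ :- κ) :* v)
             := β :* (β⁻ :+ (γ :- κ)) :* (t :* u) :+ γ :* (γ⁻ :+ (β :- κ)) :* v) refl β β⁻ γ γ⁻ t κ u v ⟩
    β * (β⁻ + (γ - κ)) * (t * u) + γ * (γ⁻ + (β - κ)) * v
      ≡⟨ cong₂ (λ y z → y * (t * u) + z * v) (ℕ→ℚ-*-pred b (γ - κ)) (ℕ→ℚ-*-pred c (β - κ)) ⟩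
    β * (β - 1ℚ + (γ - κ)) * (t * u) + γ * (γ - 1ℚ + (β - κ)) * v
      ≡⟨ solve 6 (λ β γ t κ u v → let one = con 1ℚ in
           β :* (β :- one :+ (γ :- κ)) :* (t :* u) :+ γ :* (γ :- one :+ (β :- κ)) :* v
             := (β :+ γ :- (one :+ κ)) :* (β :* (t :* u) :+ γ :* v)) refl β γ t κ u v ⟩
    (β + γ - (1ℚ + κ)) * (β * (t * u) + γ * v)
      ≡⟨ cong (λ y → (β + γ - y) * (β * (t * u) + γ * v)) (ℕ→ℚ-suc k) ⟨
    (β + γ - ℕ→ℚ (suc k)) * (β * (t * u) + γ * v) ∎
    where
    open ≡-Reasoning
    β = ℕ→ℚ b
    β⁻ = ℕ→ℚ (pred b)
    γ = ℕ→ℚ c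
    γ⁻ = ℕ→ℚ (pred c)
    κ = ℕ→ℚ k
    p = draws k (pred (pred b)) c
    q = draws k (pred b) (pred c)
    r = draws k b (pred (pred c))
    u = draws k (pred b) c
    v = draws k b (pred c)

  -- The order of weighted and unweighted positions does not matter. Each unweighted position is
  -- moved to the end by `draws-extend`, and the numbers of choices left there multiply to a
  -- factorial.
  drawsAt≡draws : ∀ {m} (A : Subset m) b c → b ℕ.+ c ≡ m →
    drawsAt A b c ≡ draws (size A) b c * ℕ→ℚ (size (∁ A) !)
  drawsAt≡draws []         b c eq = refl
  drawsAt≡draws (true ∷ A) b c eq = begin
    ℕ→ℚ b * (t * drawsAt A (pred b) c) + ℕ→ℚ c * drawsAt A b (pred c)
      ≡⟨ cong₂ _+_
           (ℕ→ℚ-*-cong b {λ b′ → t * drawsAt A b′ c} {λ b′ → t * (draws k b′ c * F)}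
             (λ { b′ refl → cong (t *_) (drawsAt≡draws A b′ c (ℕP.suc-injective eq)) }))
           (ℕ→ℚ-*-cong c {λ c′ → drawsAt A b c′} {λ c′ → draws k b c′ * F}
             (λ { c′ refl → drawsAt≡draws A b c′ (ℕP.suc-injective (trans (sym (ℕP.+-suc b c′)) eq)) })) ⟩
    ℕ→ℚ b * (t * (draws k (pred b) c * F)) + ℕ→ℚ c * (draws k b (pred c) * F)
      ≡⟨ solve 6 (λ β t u γ v F → β :* (t :* (u :* F)) :+ γ :* (v :* F) := (β :* (t :* u) :+ γ :* v) :* F) refl
           (ℕ→ℚ b) t (draws k (pred b) c) (ℕ→ℚ c) (draws k b (pred c)) F ⟩
    draws (suc k) b c * F ∎
    where
    open ≡-Reasoning
    k = size A
    F = ℕ→ℚ (size (∁ A) !)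
  drawsAt≡draws {suc m} (false ∷ A) b c eq = begin
    ℕ→ℚ b * (1ℚ * drawsAt A (pred b) c) + ℕ→ℚ c * drawsAt A b (pred c)
      ≡⟨ cong₂ _+_
           (ℕ→ℚ-*-cong b {λ b′ → 1ℚ * drawsAt A b′ c} {λ b′ → 1ℚ * (draws k b′ c * F)}
             (λ { b′ refl → cong (1ℚ *_) (drawsAt≡draws A b′ c (ℕP.suc-injective eq)) }))
           (ℕ→ℚ-*-cong c {λ c′ → drawsAt A b c′} {λ c′ → draws k b c′ * F}
             (λ { c′ refl → drawsAt≡draws A b c′ (ℕP.suc-injective (trans (sym (ℕP.+-suc b c′)) eq)) })) ⟩
    ℕ→ℚ b * (1ℚ * (draws k (pred b) c * F)) + ℕ→ℚ c * (draws k b (pred c) * F)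
      ≡⟨ solve 5 (λ β u γ v F → β :* (con 1ℚ :* (u :* F)) :+ γ :* (v :* F) := (β :* u :+ γ :* v) :* F) refl
           (ℕ→ℚ b) (draws k (pred b) c) (ℕ→ℚ c) (draws k b (pred c)) F ⟩
    (ℕ→ℚ b * draws k (pred b) c + ℕ→ℚ c * draws k b (pred c)) * F
      ≡⟨ cong (_* F) (draws-extend k b c) ⟩
    (ℕ→ℚ b + ℕ→ℚ c - ℕ→ℚ k) * draws k b c * F
      ≡⟨ cong (λ y → y * draws k b c * F) remaining ⟩
    ℕ→ℚ (suc r) * draws k b c * F
      ≡⟨ solve 3 (λ s d F → s :* d :* F := d :* (s :* F)) refl (ℕ→ℚ (suc r)) (draws k b c) F ⟩
    draws k b c * (ℕ→ℚ (suc r) * F)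
      ≡⟨ cong (draws k b c *_) (ℕ→ℚ-* (suc r) (r !)) ⟨
    draws k b c * ℕ→ℚ (suc r !) ∎
    where
    open ≡-Reasoning
    k = size A
    r = size (∁ A)
    F = ℕ→ℚ (r !)
    remaining : ℕ→ℚ b + ℕ→ℚ c - ℕ→ℚ k ≡ ℕ→ℚ (suc r)
    remaining = begin
      ℕ→ℚ b + ℕ→ℚ c - ℕ→ℚ k            ≡⟨ cong (_- ℕ→ℚ k) (ℕ→ℚ-+ b c) ⟨
      ℕ→ℚ (b ℕ.+ c) - ℕ→ℚ k            ≡⟨ cong (λ y → ℕ→ℚ y - ℕ→ℚ k) (trans eq (sym (trans (ℕP.+-suc k r) (cong suc (size+size∁ A))))) ⟩
      ℕ→ℚ (k ℕ.+ suc r) - ℕ→ℚ k        ≡⟨ cong (_- ℕ→ℚ k) (ℕ→ℚ-+ k (suc r)) ⟩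
      ℕ→ℚ k + ℕ→ℚ (suc r) - ℕ→ℚ k      ≡⟨ solve 2 (λ k r → k :+ r :- k := r) refl (ℕ→ℚ k) (ℕ→ℚ (suc r)) ⟩
      ℕ→ℚ (suc r)                      ∎

  drawsAt-∅ : ∀ n b c → b ℕ.+ c ≡ n → drawsAt (∅ {n}) b c ≡ ℕ→ℚ (n !)
  drawsAt-∅ n b c eq = begin
    drawsAt (∅ {n}) b c                                    ≡⟨ drawsAt≡draws (∅ {n}) b c eq ⟩
    draws (size (∅ {n})) b c * ℕ→ℚ (size (∁ (∅ {n})) !)    ≡⟨ cong₂ (λ k r → draws k b c * ℕ→ℚ (r !)) (∣⊥∣≡0 n) size∁∅ ⟩
    1ℚ * ℕ→ℚ (n !)                                         ≡⟨ *-identityˡ _ ⟩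
    ℕ→ℚ (n !)                                              ∎
    where
    open ≡-Reasoning
    size∁∅ : size (∁ (∅ {n})) ≡ n
    size∁∅ = trans (cong (ℕ._+ size (∁ (∅ {n}))) (sym (∣⊥∣≡0 n))) (size+size∁ (∅ {n}))

  -- Maclaurin's inequality for two-valued weights

  module _ (0≤t : 0ℚ ≤ t) where

    -- Condition on the first draw. If it has weight x, the other N = n - 1 elements have total
    -- weight W - x, and the induction hypothesis bounds the rest by a multiple of (W - x)^k. It
    -- remains to sum x (W - x)^k over all elements, which is done through the tangent line at W/n.
    -- Clearing denominators cancels N^(k+1), hence needs N > 0; taking k ≥ 1 ensures this, and
    -- lengths 0 and 1 become separate base cases.
    draws-maclaurin-step : ∀ k-1 r → let k = suc k-1 in
      (∀ b c → b ℕ.+ c ≡ k ℕ.+ r →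
        draws k b c * ℕ→ℚ (r !) * ℕ→ℚ (k ℕ.+ r) ^ k ≤ ℕ→ℚ ((k ℕ.+ r) !) * (ℕ→ℚ b * t + ℕ→ℚ c) ^ k) →
      ∀ b c → b ℕ.+ c ≡ suc k ℕ.+ r →
        draws (suc k) b c * ℕ→ℚ (r !) * ℕ→ℚ (suc k ℕ.+ r) ^ suc k ≤ ℕ→ℚ ((suc k ℕ.+ r) !) * (ℕ→ℚ b * t + ℕ→ℚ c) ^ suc k
    draws-maclaurin-step k-1 r ih b c eq = *-cancel-0< (N * N ^ k) 0<N^ (begin
      N * N ^ k * (draws (suc k) b c * F * (n * n ^ k))
        ≡⟨ solve 9 (λ N Nk β t u γ v F m → N :* Nk :* ((β :* (t :* u) :+ γ :* v) :* F :* m)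
             := N :* m :* (β :* (t :* (u :* F :* Nk)) :+ γ :* (v :* F :* Nk))) refl
             N (N ^ k) (ℕ→ℚ b) t (draws k (pred b) c) (ℕ→ℚ c) (draws k b (pred c)) F (n * n ^ k) ⟩
      N * (n * n ^ k) * (ℕ→ℚ b * (t * (draws k (pred b) c * F * N ^ k)) + ℕ→ℚ c * (draws k b (pred c) * F * N ^ k))
        ≤⟨ *-mono-0≤ˡ (N * (n * n ^ k)) (0≤* 0≤N (0≤* 0≤n (0≤^ k 0≤n))) (+-mono-≤
             (ℕ→ℚ-*-mono b {λ b′ → t * (draws k b′ c * F * N ^ k)} {λ _ → t * (G * (W - t) ^ k)} ih-b)
             (ℕ→ℚ-*-mono c {λ c′ → draws k b c′ * F * N ^ k} {λ _ → G * (W - 1ℚ) ^ k} ih-c)) ⟩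
      N * (n * n ^ k) * (ℕ→ℚ b * (t * (G * (W - t) ^ k)) + ℕ→ℚ c * (G * (W - 1ℚ) ^ k))
        ≡⟨ solve 9 (λ N n nk β t p γ q G → N :* (n :* nk) :* (β :* (t :* (G :* p)) :+ γ :* (G :* q))
             := G :* (β :* (N :* (n :* t) :* (nk :* p)) :+ γ :* (N :* (n :* con 1ℚ) :* (nk :* q)))) refl
             N n (n ^ k) (ℕ→ℚ b) t ((W - t) ^ k) (ℕ→ℚ c) ((W - 1ℚ) ^ k) G ⟩
      G * (ℕ→ℚ b * (N * (n * t) * (n ^ k * (W - t) ^ k)) + ℕ→ℚ c * (N * (n * 1ℚ) * (n ^ k * (W - 1ℚ) ^ k)))
        ≡⟨ cong₂ (λ y z → G * (ℕ→ℚ b * (N * (n * t) * y) + ℕ→ℚ c * (N * (n * 1ℚ) * z)))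
             (^-distribʳ-* n (W - t) k) (^-distribʳ-* n (W - 1ℚ) k) ⟨
      G * (ℕ→ℚ b * (N * (n * t) * (n * (W - t)) ^ k) + ℕ→ℚ c * (N * (n * 1ℚ) * (n * (W - 1ℚ)) ^ k))
        ≤⟨ *-mono-0≤ˡ G (0≤ℕ→ℚ ((k ℕ.+ r) !)) (+-mono-≤
             (ℕ→ℚ-*-mono b {λ _ → N * (n * t) * (n * (W - t)) ^ k} {λ _ → (N * W) ^ k * (N * W + δ * (n * t - W))}
               (λ b′ b≡ → tangent-at-mean (k ℕ.+ r) k (ℕP.m≤m+n k r) 0≤t (t≤W b′ b≡)))
             (ℕ→ℚ-*-mono c {λ _ → N * (n * 1ℚ) * (n * (W - 1ℚ)) ^ k} {λ _ → (N * W) ^ k * (N * W + δ * (n * 1ℚ - W))}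
               (λ c′ c≡ → tangent-at-mean (k ℕ.+ r) k (ℕP.m≤m+n k r) 0≤1 (1≤W c′ c≡)))) ⟩
      G * (ℕ→ℚ b * ((N * W) ^ k * (N * W + δ * (n * t - W))) + ℕ→ℚ c * ((N * W) ^ k * (N * W + δ * (n * 1ℚ - W))))
        -- With n = b + c the linear deviations cancel: b(nt - W) + c(n - W) = nW - (b + c)W = 0.
        ≡⟨ cong (λ n → G * (ℕ→ℚ b * ((N * W) ^ k * (N * W + δ * (n * t - W))) + ℕ→ℚ c * ((N * W) ^ k * (N * W + δ * (n * 1ℚ - W))))) n≡b+c ⟩
      G * (ℕ→ℚ b * ((N * W) ^ k * (N * W + δ * ((ℕ→ℚ b + ℕ→ℚ c) * t - W))) + ℕ→ℚ c * ((N * W) ^ k * (N * W + δ * ((ℕ→ℚ b + ℕ→ℚ c) * 1ℚ - W))))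
        ≡⟨ solve 7 (λ β γ t G Q N δ → let W = β :* t :+ γ in
             G :* (β :* (Q :* (N :* W :+ δ :* ((β :+ γ) :* t :- W))) :+ γ :* (Q :* (N :* W :+ δ :* ((β :+ γ) :* con 1ℚ :- W))))
               := (β :+ γ) :* G :* (N :* W :* Q)) refl (ℕ→ℚ b) (ℕ→ℚ c) t G ((N * W) ^ k) N δ ⟩
      (ℕ→ℚ b + ℕ→ℚ c) * G * (N * W * (N * W) ^ k)
        ≡⟨ cong₂ (λ y z → y * G * (N * W * z)) (sym n≡b+c) (^-distribʳ-* N W k) ⟩
      n * G * (N * W * (N ^ k * W ^ k))
        ≡⟨ cong (_* (N * W * (N ^ k * W ^ k))) (ℕ→ℚ-* (suc (k ℕ.+ r)) ((k ℕ.+ r) !)) ⟨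
      ℕ→ℚ ((suc k ℕ.+ r) !) * (N * W * (N ^ k * W ^ k))
        ≡⟨ solve 5 (λ g N W p q → g :* (N :* W :* (p :* q)) := N :* p :* (g :* (W :* q))) refl
             (ℕ→ℚ ((suc k ℕ.+ r) !)) N W (N ^ k) (W ^ k) ⟩
      N * N ^ k * (ℕ→ℚ ((suc k ℕ.+ r) !) * (W * W ^ k)) ∎)
      where
      open ≤-Reasoning
      k = suc k-1
      N = ℕ→ℚ (k ℕ.+ r)
      n = ℕ→ℚ (suc k ℕ.+ r)
      F = ℕ→ℚ (r !)
      G = ℕ→ℚ ((k ℕ.+ r) !)
      W = ℕ→ℚ b * t + ℕ→ℚ c
      δ = N - ℕ→ℚ k
      0≤N = 0≤ℕ→ℚ (k ℕ.+ r)
      0≤n = 0≤ℕ→ℚ (suc k ℕ.+ r)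
      0<N^ : 0ℚ < N * N ^ k
      0<N^ = 0<^ (suc k) (ℕ→ℚ-pos (k-1 ℕ.+ r))
      n≡b+c : n ≡ ℕ→ℚ b + ℕ→ℚ c
      n≡b+c = trans (cong ℕ→ℚ (sym eq)) (ℕ→ℚ-+ b c)
      W-t : ∀ b′ → b ≡ suc b′ → W ≡ t + (ℕ→ℚ b′ * t + ℕ→ℚ c)
      W-t b′ refl = trans (cong (λ y → y * t + ℕ→ℚ c) (ℕ→ℚ-suc b′))
        (solve 3 (λ β t γ → (con 1ℚ :+ β) :* t :+ γ := t :+ (β :* t :+ γ)) refl (ℕ→ℚ b′) t (ℕ→ℚ c))
      W-1 : ∀ c′ → c ≡ suc c′ → W ≡ 1ℚ + (ℕ→ℚ b * t + ℕ→ℚ c′)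
      W-1 c′ refl = trans (cong (ℕ→ℚ b * t +_) (ℕ→ℚ-suc c′))
        (solve 3 (λ β t γ → β :* t :+ (con 1ℚ :+ γ) := con 1ℚ :+ (β :* t :+ γ)) refl (ℕ→ℚ b) t (ℕ→ℚ c′))
      t≤W : ∀ b′ → b ≡ suc b′ → t ≤ W
      t≤W b′ b≡ = ≤-diff _ (0≤+ (0≤* (0≤ℕ→ℚ b′) 0≤t) (0≤ℕ→ℚ c)) (W-t b′ b≡)
      1≤W : ∀ c′ → c ≡ suc c′ → 1ℚ ≤ W
      1≤W c′ c≡ = ≤-diff _ (0≤+ (0≤* (0≤ℕ→ℚ b) 0≤t) (0≤ℕ→ℚ c′)) (W-1 c′ c≡)
      cancel : ∀ {w} x y → w ≡ x + y → y ≡ w - x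
      cancel x y refl = solve 2 (λ x y → y := x :+ y :- x) refl x y
      ih-b : ∀ b′ → b ≡ suc b′ → t * (draws k b′ c * F * N ^ k) ≤ t * (G * (W - t) ^ k)
      ih-b b′ b≡ = *-mono-0≤ˡ t 0≤t (≤-trans
        (ih b′ c (ℕP.suc-injective (trans (sym (cong (ℕ._+ c) b≡)) eq)))
        (≤-reflexive (cong (λ y → G * y ^ k) (cancel t (ℕ→ℚ b′ * t + ℕ→ℚ c) (W-t b′ b≡)))))
      ih-c : ∀ c′ → c ≡ suc c′ → draws k b c′ * F * N ^ k ≤ G * (W - 1ℚ) ^ k
      ih-c c′ c≡ = ≤-trans
        (ih b c′ (ℕP.suc-injective (trans (sym (ℕP.+-suc b c′)) (trans (sym (cong (b ℕ.+_) c≡)) eq))))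
        (≤-reflexive (cong (λ y → G * y ^ k) (cancel 1ℚ (ℕ→ℚ b * t + ℕ→ℚ c′) (W-1 c′ c≡))))

    -- Maclaurin's inequality e_k / C(n,k) ≤ (e_1 / n)^k for a two-valued weight.
    draws-maclaurin : ∀ k r b c → b ℕ.+ c ≡ k ℕ.+ r →
      draws k b c * ℕ→ℚ (r !) * ℕ→ℚ (k ℕ.+ r) ^ k ≤ ℕ→ℚ ((k ℕ.+ r) !) * (ℕ→ℚ b * t + ℕ→ℚ c) ^ k
    draws-maclaurin zero r b c eq = ≤-reflexive
      (solve 1 (λ f → con 1ℚ :* f :* con 1ℚ := f :* con 1ℚ) refl (ℕ→ℚ (r !)))
    draws-maclaurin (suc zero) r b c eq = ≤-reflexive (trans
      (solve 5 (λ β γ t f n → (β :* (t :* con 1ℚ) :+ γ :* con 1ℚ) :* f :* (n :* con 1ℚ) := n :* f :* ((β :* t :+ γ) :* con 1ℚ))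
         refl (ℕ→ℚ b) (ℕ→ℚ c) t (ℕ→ℚ (r !)) (ℕ→ℚ (suc r)))
      (cong (_* ((ℕ→ℚ b * t + ℕ→ℚ c) * 1ℚ)) (sym (ℕ→ℚ-* (suc r) (r !)))))
    draws-maclaurin (suc k@(suc k-1)) r b c eq = draws-maclaurin-step k-1 r (draws-maclaurin k r) b c eq

    drawsAt-maclaurin : ∀ {n} (A : Subset n) b c → b ℕ.+ c ≡ n →
      drawsAt A b c * ℕ→ℚ n ^ size A ≤ ℕ→ℚ (n !) * (ℕ→ℚ b * t + ℕ→ℚ c) ^ size A
    drawsAt-maclaurin {n} A b c eq = subst₂ _≤_
      (cong₂ (λ x y → x * ℕ→ℚ y ^ size A) (sym (drawsAt≡draws A b c eq)) (size+size∁ A))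
      (cong (λ y → ℕ→ℚ (y !) * (ℕ→ℚ b * t + ℕ→ℚ c) ^ size A) (size+size∁ A))
      (draws-maclaurin (size A) (size (∁ A)) b c (trans eq (sym (size+size∁ A))))

-- Sums over permutations and edge counts

private variable
  X Y : Set

∑ : List X → (X → ℚ) → ℚ
∑ []       f = 0ℚ
∑ (x ∷ xs) f = f x + ∑ xs f

∑-cong : ∀ (xs : List X) {f g : X → ℚ} → (∀ x → f x ≡ g x) → ∑ xs f ≡ ∑ xs g
∑-cong []       eq = refl
∑-cong (x ∷ xs) eq = cong₂ _+_ (eq x) (∑-cong xs eq)

∑-cong-∈ : ∀ (xs : List X) {f g : X → ℚ} → (∀ x → x ∈ xs → f x ≡ g x) → ∑ xs f ≡ ∑ xs g
∑-cong-∈ []       eq = refl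
∑-cong-∈ (x ∷ xs) eq = cong₂ _+_ (eq x (here refl)) (∑-cong-∈ xs (λ y y∈xs → eq y (there y∈xs)))

∑-mono : ∀ (xs : List X) {f g : X → ℚ} → (∀ x → f x ≤ g x) → ∑ xs f ≤ ∑ xs g
∑-mono []       le = ≤-refl
∑-mono (x ∷ xs) le = +-mono-≤ (le x) (∑-mono xs le)

∑-+ : ∀ (xs : List X) (f g : X → ℚ) → ∑ xs (λ x → f x + g x) ≡ ∑ xs f + ∑ xs g
∑-+ []       f g = refl
∑-+ (x ∷ xs) f g = trans (cong (f x + g x +_) (∑-+ xs f g))
  (solve 4 (λ a b c d → a :+ b :+ (c :+ d) := a :+ c :+ (b :+ d)) refl (f x) (g x) (∑ xs f) (∑ xs g))

∑-*ˡ : ∀ (xs : List X) c (f : X → ℚ) → ∑ xs (λ x → c * f x) ≡ c * ∑ xs f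
∑-*ˡ []       c f = sym (*-zeroʳ c)
∑-*ˡ (x ∷ xs) c f = trans (cong (c * f x +_) (∑-*ˡ xs c f)) (sym (*-distribˡ-+ c (f x) (∑ xs f)))

∑-zero : ∀ (xs : List X) → ∑ xs (λ _ → 0ℚ) ≡ 0ℚ
∑-zero []       = refl
∑-zero (x ∷ xs) = trans (+-identityˡ _) (∑-zero xs)

∑-one : ∀ (xs : List X) → ∑ xs (λ _ → 1ℚ) ≡ ℕ→ℚ (length xs)
∑-one []       = refl
∑-one (x ∷ xs) = trans (cong (1ℚ +_) (∑-one xs)) (sym (ℕ→ℚ-suc (length xs)))

∑-++ : ∀ (xs ys : List X) (f : X → ℚ) → ∑ (xs ++ ys) f ≡ ∑ xs f + ∑ ys f
∑-++ []       ys f = sym (+-identityˡ _)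
∑-++ (x ∷ xs) ys f = trans (cong (f x +_) (∑-++ xs ys f)) (sym (+-assoc (f x) (∑ xs f) (∑ ys f)))

∑-map : ∀ (h : X → Y) xs (f : Y → ℚ) → ∑ (map h xs) f ≡ ∑ xs (f ∘ h)
∑-map h []       f = refl
∑-map h (x ∷ xs) f = cong (f (h x) +_) (∑-map h xs f)

∑-concatMap : ∀ (h : X → List Y) xs (f : Y → ℚ) → ∑ (concatMap h xs) f ≡ ∑ xs (λ x → ∑ (h x) f)
∑-concatMap h []       f = refl
∑-concatMap h (x ∷ xs) f = trans (∑-++ (h x) (concatMap h xs) f) (cong (∑ (h x) f +_) (∑-concatMap h xs f))

∑-filter : ∀ {P : Pred X 0ℓ} (P? : Decidable P) xs (f : X → ℚ) →
  ∑ (filter P? xs) f ≡ ∑ xs (λ x → if does (P? x) then f x else 0ℚ)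
∑-filter P? []       f = refl
∑-filter P? (x ∷ xs) f with does (P? x)
... | true  = cong (f x +_) (∑-filter P? xs f)
... | false = trans (∑-filter P? xs f) (sym (+-identityˡ _))

∑-allVecs-suc : ∀ m (xs : List X) (f : Vec X (suc m) → ℚ) →
  ∑ (allVecs (suc m) xs) f ≡ ∑ xs (λ x → ∑ (allVecs m xs) (λ v → f (x ∷ v)))
∑-allVecs-suc m xs f = trans (∑-concatMap (λ x → map (x ∷_) (allVecs m xs)) xs f)
  (∑-cong xs (λ x → ∑-map (x ∷_) (allVecs m xs) f))

∏ : ∀ {m} → Vec X m → (X → ℚ) → ℚ
∏ []      f = 1ℚ
∏ (x ∷ v) f = f x * ∏ v f

∏-one : ∀ {m} (v : Vec X m) → ∏ v (λ _ → 1ℚ) ≡ 1ℚ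
∏-one []      = refl
∏-one (x ∷ v) = trans (*-identityˡ _) (∏-one v)

-- Independence of the coordinates, in counting form.
∑-∏ : ∀ m (xs : List X) (f : X → ℚ) → ∑ (allVecs m xs) (λ v → ∏ v f) ≡ ∑ xs f ^ m
∑-∏ zero    xs f = refl
∑-∏ (suc m) xs f = begin
  ∑ (allVecs (suc m) xs) (λ v → ∏ v f)                   ≡⟨ ∑-allVecs-suc m xs (λ v → ∏ v f) ⟩
  ∑ xs (λ x → ∑ (allVecs m xs) (λ v → f x * ∏ v f))      ≡⟨ ∑-cong xs (λ x → trans (∑-*ˡ (allVecs m xs) (f x) (λ v → ∏ v f))
                                                              (trans (cong (f x *_) (∑-∏ m xs f)) (*-comm (f x) _))) ⟩
  ∑ xs (λ x → ∑ xs f ^ m * f x)                          ≡⟨ ∑-*ˡ xs (∑ xs f ^ m) f ⟩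
  ∑ xs f ^ m * ∑ xs f                                    ≡⟨ *-comm _ (∑ xs f) ⟩
  ∑ xs f * ∑ xs f ^ m                                    ∎
  where open ≡-Reasoning

length-allVecs : ∀ m (xs : List X) → ℕ→ℚ (length (allVecs m xs)) ≡ ℕ→ℚ (length xs) ^ m
length-allVecs m xs = begin
  ℕ→ℚ (length (allVecs m xs))              ≡⟨ ∑-one (allVecs m xs) ⟨
  ∑ (allVecs m xs) (λ _ → 1ℚ)              ≡⟨ ∑-cong (allVecs m xs) (λ v → sym (∏-one v)) ⟩
  ∑ (allVecs m xs) (λ v → ∏ v (λ _ → 1ℚ))  ≡⟨ ∑-∏ m xs (λ _ → 1ℚ) ⟩
  ∑ xs (λ _ → 1ℚ) ^ m                      ≡⟨ cong (_^ m) (∑-one xs) ⟩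
  ℕ→ℚ (length xs) ^ m                      ∎
  where open ≡-Reasoning

-- Turns a condition on all entries into a smaller alphabet. Applied to "different from the head",
-- it makes injective vectors into draws without replacement.
∑-allVecs-all : ∀ {P : Pred X 0ℓ} (P? : Decidable P) m (xs : List X) (f : Vec X m → ℚ) →
  ∑ (allVecs m xs) (λ v → if does (all? P? (toList v)) then f v else 0ℚ) ≡ ∑ (allVecs m (filter P? xs)) f
∑-allVecs-all P? zero    xs f = refl
∑-allVecs-all P? (suc m) xs f = begin
  ∑ (allVecs (suc m) xs) (λ v → if does (all? P? (toList v)) then f v else 0ℚ)
    ≡⟨ ∑-allVecs-suc m xs _ ⟩
  ∑ xs (λ x → ∑ (allVecs m xs) (λ v → if does (P? x) ∧ does (all? P? (toList v)) then f (x ∷ v) else 0ℚ))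
    ≡⟨ ∑-cong xs head ⟩
  ∑ xs (λ x → if does (P? x) then ∑ (allVecs m (filter P? xs)) (λ v → f (x ∷ v)) else 0ℚ)
    ≡⟨ ∑-filter P? xs _ ⟨
  ∑ (filter P? xs) (λ x → ∑ (allVecs m (filter P? xs)) (λ v → f (x ∷ v)))
    ≡⟨ ∑-allVecs-suc m (filter P? xs) f ⟨
  ∑ (allVecs (suc m) (filter P? xs)) f ∎
  where
  open ≡-Reasoning
  head : ∀ x → ∑ (allVecs m xs) (λ v → if does (P? x) ∧ does (all? P? (toList v)) then f (x ∷ v) else 0ℚ)
             ≡ (if does (P? x) then ∑ (allVecs m (filter P? xs)) (λ v → f (x ∷ v)) else 0ℚ)
  head x with does (P? x)
  ... | true  = ∑-allVecs-all P? m xs (λ v → f (x ∷ v))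
  ... | false = ∑-zero (allVecs m xs)

-- Counting in lists without repetition

count : (X → Bool) → List X → ℕ
count f []       = 0
count f (x ∷ xs) = if f x then suc (count f xs) else count f xs

∑-if : ∀ (f : X → Bool) xs y z →
  ∑ xs (λ x → if f x then y else z) ≡ ℕ→ℚ (count f xs) * y + ℕ→ℚ (count (not ∘ f) xs) * z
∑-if f []       y z = solve 2 (λ y z → con 0ℚ := con 0ℚ :* y :+ con 0ℚ :* z) refl y z
∑-if f (x ∷ xs) y z with f x
... | true  = trans (cong (y +_) (∑-if f xs y z)) (trans
  (solve 4 (λ y z a b → y :+ (a :* y :+ b :* z) := (con 1ℚ :+ a) :* y :+ b :* z) refl y z (ℕ→ℚ a) (ℕ→ℚ b))
  (cong (λ a → a * y + ℕ→ℚ b * z) (sym (ℕ→ℚ-suc a))))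
  where
  a = count f xs
  b = count (not ∘ f) xs
... | false = trans (cong (z +_) (∑-if f xs y z)) (trans
  (solve 4 (λ y z a b → z :+ (a :* y :+ b :* z) := a :* y :+ (con 1ℚ :+ b) :* z) refl y z (ℕ→ℚ a) (ℕ→ℚ b))
  (cong (λ b → ℕ→ℚ a * y + b * z) (sym (ℕ→ℚ-suc b))))
  where
  a = count f xs
  b = count (not ∘ f) xs

infixl 6 _∖_
_∖_ : ∀ {n} → List (Fin n) → Fin n → List (Fin n)
xs ∖ x = filter (λ y → ¬? (x ≟ y)) xs

-- Deletion removes every occurrence of `x`; uniqueness ensures that there is only one, so that a
-- single `pred` accounts for it.
count-∖ : ∀ {n} (f : Fin n → Bool) {xs x} → Unique xs → x ∈ xs →
  count f (xs ∖ x) ≡ (if f x then pred (count f xs) else count f xs)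
count-∖ f {x ∷ xs} (x∉xs ∷ _) (here refl) with x ≟ x
... | no x≢x = ⊥-elim (x≢x refl)
... | yes _ rewrite filter-all (λ y → ¬? (x ≟ y)) x∉xs with f x
...   | true  = refl
...   | false = refl
count-∖ f {y ∷ xs} {x} (y∉xs ∷ u) (there x∈xs) with x ≟ y
... | yes refl = ⊥-elim (All.lookup y∉xs x∈xs refl)
... | no _ with f y | f x in fx | count-∖ f u x∈xs
...   | false | _     | ih = ih
...   | true  | false | ih = cong suc ih
...   | true  | true  | ih = trans (cong suc ih) (suc-pred-count fx x∈xs)
  where
  suc-pred-count : ∀ {x xs} → f x ≡ true → x ∈ xs → suc (pred (count f xs)) ≡ count f xs
  suc-pred-count {xs = y ∷ xs} fx (here refl) rewrite fx = refl
  suc-pred-count {xs = y ∷ xs} fx (there x∈xs) with f y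
  ... | true  = refl
  ... | false = suc-pred-count fx x∈xs

count-tabulate : ∀ {k} (f : X → Bool) (g : Fin k → X) → count f (tabulate g) ≡ size (Vec.tabulate (f ∘ g))
count-tabulate {k = zero}  f g = refl
count-tabulate {k = suc k} f g with f (g zero)
... | true  = cong suc (count-tabulate f (g ∘ suc))
... | false = count-tabulate f (g ∘ suc)

count-allFin : ∀ {n} (B : Subset n) → count (lookup B) (allFin n) ≡ size B
count-allFin B = trans (count-tabulate (lookup B) id) (cong size (VecP.tabulate∘lookup B))

count-not-allFin : ∀ {n} (B : Subset n) → count (not ∘ lookup B) (allFin n) ≡ size (∁ B)
count-not-allFin B = trans (count-tabulate (not ∘ lookup B) id)
  (cong size (trans (VecP.tabulate-∘ not (lookup B)) (cong (Vec.map not) (VecP.tabulate∘lookup B))))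

-- Generating function of a random permutation

module _ (t : ℚ) {n : ℕ} (B : Subset n) where

  -- The multiplicative form of `t ^ edges A B v`. The length `m` is kept apart from `n`, so that
  -- positions can be removed one by one while the entries stay in `Fin n`.
  weight : ∀ {m} → Subset m → Vec (Fin n) m → ℚ
  weight []      []      = 1ℚ
  weight (a ∷ A) (x ∷ v) = (if a then (if lookup B x then t else 1ℚ) else 1ℚ) * weight A v

  weight-∅ : ∀ {m} (v : Vec (Fin n) m) → weight ∅ v ≡ 1ℚ
  weight-∅ []      = refl
  weight-∅ (x ∷ v) = trans (*-identityˡ _) (weight-∅ v)

  uniqueWeight : ∀ {m} → Subset m → Vec (Fin n) m → ℚ
  uniqueWeight A v = if does (UniqueDec.unique? _≟_ (toList v)) then weight A v else 0ℚ

  ∑-uniqueWeight-∷ : ∀ {m} a (A : Subset m) xs →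
    ∑ (allVecs (suc m) xs) (uniqueWeight (a ∷ A))
      ≡ ∑ xs (λ x → (if a then (if lookup B x then t else 1ℚ) else 1ℚ) * ∑ (allVecs m (xs ∖ x)) (uniqueWeight A))
  ∑-uniqueWeight-∷ {m} a A xs = trans (∑-allVecs-suc m xs (uniqueWeight (a ∷ A))) (∑-cong xs λ x → begin
    ∑ (allVecs m xs) (λ v → uniqueWeight (a ∷ A) (x ∷ v))
      ≡⟨ ∑-cong (allVecs m xs) (λ v → split x v) ⟩
    ∑ (allVecs m xs) (λ v → if does (all? (λ y → ¬? (x ≟ y)) (toList v)) then w x * uniqueWeight A v else 0ℚ)
      ≡⟨ ∑-allVecs-all (λ y → ¬? (x ≟ y)) m xs (λ v → w x * uniqueWeight A v) ⟩
    ∑ (allVecs m (xs ∖ x)) (λ v → w x * uniqueWeight A v)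
      ≡⟨ ∑-*ˡ (allVecs m (xs ∖ x)) (w x) (uniqueWeight A) ⟩
    w x * ∑ (allVecs m (xs ∖ x)) (uniqueWeight A) ∎)
    where
    open ≡-Reasoning
    w : Fin n → ℚ
    w x = if a then (if lookup B x then t else 1ℚ) else 1ℚ
    split : ∀ x v → uniqueWeight (a ∷ A) (x ∷ v)
                  ≡ (if does (all? (λ y → ¬? (x ≟ y)) (toList v)) then w x * uniqueWeight A v else 0ℚ)
    -- `unique?` on `x ∷ v` computes to the conjunction of these two Booleans: the head is fresh,
    -- and the tail is unique.
    split x v with does (all? (λ y → ¬? (x ≟ y)) (toList v)) | does (UniqueDec.unique? _≟_ (toList v))
    ... | true  | true  = refl
    ... | true  | false = sym (*-zeroʳ (w x))
    ... | false | _     = refl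

  -- The alphabet must be arbitrary because it shrinks after each draw. The sum depends on it only
  -- through the numbers of its elements inside and outside `B`, which is what lets `drawsAt`
  -- recurse on two numbers.
  ∑-uniqueWeight : ∀ {m} (A : Subset m) {xs} → Unique xs →
    ∑ (allVecs m xs) (uniqueWeight A) ≡ drawsAt t A (count (lookup B) xs) (count (not ∘ lookup B) xs)
  ∑-uniqueWeight []      u = refl
  ∑-uniqueWeight {suc m} (a ∷ A) {xs} u = begin
    ∑ (allVecs (suc m) xs) (uniqueWeight (a ∷ A))
      ≡⟨ ∑-uniqueWeight-∷ a A xs ⟩
    ∑ xs (λ x → w x * ∑ (allVecs m (xs ∖ x)) (uniqueWeight A))
      ≡⟨ ∑-cong-∈ xs step ⟩
    ∑ xs (λ x → if lookup B x then (if a then t else 1ℚ) * drawsAt t A (pred b) c else drawsAt t A b (pred c))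
      ≡⟨ ∑-if (lookup B) xs _ _ ⟩
    drawsAt t (a ∷ A) b c ∎
    where
    open ≡-Reasoning
    b = count (lookup B) xs
    c = count (not ∘ lookup B) xs
    w : Fin n → ℚ
    w x = if a then (if lookup B x then t else 1ℚ) else 1ℚ
    if-const : ∀ a → (if a then 1ℚ else 1ℚ) ≡ 1ℚ
    if-const true  = refl
    if-const false = refl
    step : ∀ x → x ∈ xs → w x * ∑ (allVecs m (xs ∖ x)) (uniqueWeight A)
      ≡ (if lookup B x then (if a then t else 1ℚ) * drawsAt t A (pred b) c else drawsAt t A b (pred c))
    step x x∈xs
      rewrite ∑-uniqueWeight A (Unique.filter⁺ (λ y → ¬? (x ≟ y)) u)
            | count-∖ (lookup B) u x∈xs
            | count-∖ (not ∘ lookup B) u x∈xs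
      with lookup B x
    ... | true  = refl
    ... | false = trans (cong (_* drawsAt t A b (pred c)) (if-const a)) (*-identityˡ _)

  ∑-allPerms : ∀ (A : Subset n) → ∑ (allPerms n) (weight A) ≡ drawsAt t A (size B) (size (∁ B))
  ∑-allPerms A = begin
    ∑ (allPerms n) (weight A)                          ≡⟨ ∑-filter isPerm? (allVecs n (allFin n)) (weight A) ⟩
    ∑ (allVecs n (allFin n)) (uniqueWeight A)          ≡⟨ ∑-uniqueWeight A (Unique.allFin⁺ n) ⟩
    drawsAt t A (count (lookup B) (allFin n)) (count (not ∘ lookup B) (allFin n))
                                                       ≡⟨ cong₂ (drawsAt t A) (count-allFin B) (count-not-allFin B) ⟩
    drawsAt t A (size B) (size (∁ B))                  ∎
    where open ≡-Reasoning

-- Taking both sets empty makes every weight 1, so the number of permutations comes out of the same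
-- generating function.
length-allPerms : ∀ n → ℕ→ℚ (length (allPerms n)) ≡ ℕ→ℚ (n !)
length-allPerms n = begin
  ℕ→ℚ (length (allPerms n))              ≡⟨ ∑-one (allPerms n) ⟨
  ∑ (allPerms n) (λ _ → 1ℚ)              ≡⟨ ∑-cong (allPerms n) (λ σ → sym (weight-∅ 1ℚ {n} ∅ σ)) ⟩
  ∑ (allPerms n) (weight 1ℚ {n} ∅ ∅)         ≡⟨ ∑-allPerms 1ℚ {n} ∅ ∅ ⟩
  drawsAt 1ℚ (∅ {n}) (size (∅ {n})) (size (∁ (∅ {n})))   ≡⟨ drawsAt-∅ 1ℚ n _ _ (size+size∁ (∅ {n})) ⟩
  ℕ→ℚ (n !)                              ∎
  where open ≡-Reasoning

-- Edge counts as exponents of the weight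

∈?-lookup : ∀ {n} i (A : Subset n) → ⌊ i ∈? A ⌋ ≡ lookup A i
∈?-lookup i A = trans (isYes≗does (i ∈? A)) (go i A)
  where
  go : ∀ {n} i (A : Subset n) → does (i ∈? A) ≡ lookup A i
  go zero    (true ∷ A)  = refl
  go zero    (false ∷ A) = refl
  go (suc i) (a ∷ A)     = go i A

sumOver-tabulate : ∀ {n} (A : Subset n) f → sumOver A f ≡ sum (tabulate (λ i → if lookup A i then f i else 0))
sumOver-tabulate A f = trans (cong sum (map-tabulate id (λ i → if ⌊ i ∈? A ⌋ then f i else 0)))
  (go (λ i → cong (λ b → if b then f i else 0) (∈?-lookup i A)))
  where
  go : ∀ {k} {g h : Fin k → ℕ} → (∀ i → g i ≡ h i) → sum (tabulate g) ≡ sum (tabulate h)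
  go {zero}  eq = refl
  go {suc k} eq = cong₂ ℕ._+_ (eq zero) (go (eq ∘ suc))

sumOver-∷ : ∀ {n} a (A : Subset n) f →
  sumOver (a ∷ A) f ≡ (if a then f zero else 0) ℕ.+ sumOver A (f ∘ suc)
sumOver-∷ a A f = trans (sumOver-tabulate (a ∷ A) f)
  (cong ((if a then f zero else 0) ℕ.+_) (sym (sumOver-tabulate A (f ∘ suc))))

sumOver-cong : ∀ {n} (A : Subset n) {f g} → (∀ i → f i ≡ g i) → sumOver A f ≡ sumOver A g
sumOver-cong []      eq = refl
sumOver-cong (a ∷ A) {f} {g} eq = trans (sumOver-∷ a A f) (trans
  (cong₂ (λ x y → (if a then x else 0) ℕ.+ y) (eq zero) (sumOver-cong A (eq ∘ suc)))
  (sym (sumOver-∷ a A g)))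

sumOver-zero : ∀ {n} (A : Subset n) → sumOver A (λ _ → 0) ≡ 0
sumOver-zero []          = refl
sumOver-zero (true ∷ A)  = trans (sumOver-∷ true A (λ _ → 0)) (sumOver-zero A)
sumOver-zero (false ∷ A) = trans (sumOver-∷ false A (λ _ → 0)) (sumOver-zero A)

sumOver-+ : ∀ {n} (A : Subset n) f g → sumOver A (λ i → f i ℕ.+ g i) ≡ sumOver A f ℕ.+ sumOver A g
sumOver-+ []      f g = refl
sumOver-+ (a ∷ A) f g = begin
  sumOver (a ∷ A) (λ i → f i ℕ.+ g i)
    ≡⟨ sumOver-∷ a A (λ i → f i ℕ.+ g i) ⟩
  (if a then f zero ℕ.+ g zero else 0) ℕ.+ sumOver A (λ i → f (suc i) ℕ.+ g (suc i))
    ≡⟨ cong₂ ℕ._+_ (if-+ a) (sumOver-+ A (f ∘ suc) (g ∘ suc)) ⟩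
  ((if a then f zero else 0) ℕ.+ (if a then g zero else 0)) ℕ.+ (sumOver A (f ∘ suc) ℕ.+ sumOver A (g ∘ suc))
    ≡⟨ interchange (if a then f zero else 0) (if a then g zero else 0) (sumOver A (f ∘ suc)) (sumOver A (g ∘ suc)) ⟩
  ((if a then f zero else 0) ℕ.+ sumOver A (f ∘ suc)) ℕ.+ ((if a then g zero else 0) ℕ.+ sumOver A (g ∘ suc))
    ≡⟨ cong₂ ℕ._+_ (sumOver-∷ a A f) (sumOver-∷ a A g) ⟨
  sumOver (a ∷ A) f ℕ.+ sumOver (a ∷ A) g ∎
  where
  open ≡-Reasoning
  open import Algebra.Properties.CommutativeSemigroup ℕP.+-commutativeSemigroup using (interchange)
  if-+ : ∀ a → (if a then f zero ℕ.+ g zero else 0) ≡ (if a then f zero else 0) ℕ.+ (if a then g zero else 0)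
  if-+ true  = refl
  if-+ false = refl

sumOver-indicator : ∀ {n} (B : Subset n) x → sumOver B (λ j → if ⌊ x ≟ j ⌋ then 1 else 0) ≡ (if lookup B x then 1 else 0)
sumOver-indicator (b ∷ B) zero = trans (sumOver-∷ b B (λ j → if ⌊ zero ≟ j ⌋ then 1 else 0))
  (trans (cong ((if b then 1 else 0) ℕ.+_) (sumOver-zero B)) (ℕP.+-identityʳ _))
sumOver-indicator (b ∷ B) (suc x) = begin
  sumOver (b ∷ B) (λ j → if ⌊ suc x ≟ j ⌋ then 1 else 0)
    ≡⟨ sumOver-∷ b B (λ j → if ⌊ suc x ≟ j ⌋ then 1 else 0) ⟩
  (if b then 0 else 0) ℕ.+ sumOver B (λ j → if ⌊ suc x ≟ suc j ⌋ then 1 else 0)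
    ≡⟨ cong₂ ℕ._+_ (if-zero b) (sumOver-cong B (λ j → cong (λ d → if d then 1 else 0) (suc-≟ j))) ⟩
  sumOver B (λ j → if ⌊ x ≟ j ⌋ then 1 else 0)
    ≡⟨ sumOver-indicator B x ⟩
  (if lookup B x then 1 else 0) ∎
  where
  open ≡-Reasoning
  if-zero : ∀ b → (if b then 0 else 0) ≡ 0
  if-zero true  = refl
  if-zero false = refl
  suc-≟ : ∀ j → ⌊ suc x ≟ suc j ⌋ ≡ ⌊ x ≟ j ⌋
  suc-≟ j = trans (isYes≗does (suc x ≟ suc j)) (sym (isYes≗does (x ≟ j)))

edges : ∀ {m n} → Subset m → Subset n → Vec (Fin n) m → ℕ
edges A B v = sumOver A (λ i → if lookup B (lookup v i) then 1 else 0)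

eΛ-∷ : ∀ {n d} (A B : Subset n) σ (σs : Vec (Perm n) d) → eΛ (σ ∷ σs) A B ≡ edges A B σ ℕ.+ eΛ σs A B
eΛ-∷ A B σ σs = begin
  sumOver A (λ i → sumOver B (λ j → permMatrix σ i j ℕ.+ M σs i j))
    ≡⟨ sumOver-cong A (λ i → trans (sumOver-+ B (permMatrix σ i) (M σs i))
         (cong (ℕ._+ sumOver B (M σs i)) (sumOver-indicator B (lookup σ i)))) ⟩
  sumOver A (λ i → (if lookup B (lookup σ i) then 1 else 0) ℕ.+ sumOver B (M σs i))
    ≡⟨ sumOver-+ A (λ i → if lookup B (lookup σ i) then 1 else 0) (λ i → sumOver B (M σs i)) ⟩
  edges A B σ ℕ.+ eΛ σs A B ∎
  where open ≡-Reasoning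

eΛ-[] : ∀ {n} (A B : Subset n) → eΛ [] A B ≡ 0
eΛ-[] A B = trans (sumOver-cong A (λ i → sumOver-zero B)) (sumOver-zero A)

^-edges : ∀ {m n} t (A : Subset m) (B : Subset n) v → t ^ edges A B v ≡ weight t B A v
^-edges t []      B []      = refl
^-edges t (a ∷ A) B (x ∷ v) = begin
  t ^ edges (a ∷ A) B (x ∷ v)                                          ≡⟨ cong (t ^_) (sumOver-∷ a A (λ i → if lookup B (lookup (x ∷ v) i) then 1 else 0)) ⟩
  t ^ ((if a then (if lookup B x then 1 else 0) else 0) ℕ.+ edges A B v)  ≡⟨ ^-distribˡ-+ t (if a then (if lookup B x then 1 else 0) else 0) (edges A B v) ⟩
  t ^ (if a then (if lookup B x then 1 else 0) else 0) * t ^ edges A B v  ≡⟨ cong₂ _*_ (^-if a (lookup B x)) (^-edges t A B v) ⟩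
  (if a then (if lookup B x then t else 1ℚ) else 1ℚ) * weight t B A v    ∎
  where
  open ≡-Reasoning
  ^-if : ∀ a b → t ^ (if a then (if b then 1 else 0) else 0) ≡ (if a then (if b then t else 1ℚ) else 1ℚ)
  ^-if true  true  = *-identityʳ t
  ^-if true  false = refl
  ^-if false b     = refl

^-eΛ : ∀ {n d} t (A B : Subset n) (σs : Vec (Perm n) d) → t ^ eΛ σs A B ≡ ∏ σs (weight t B A)
^-eΛ t A B []       = cong (t ^_) (eΛ-[] A B)
^-eΛ t A B (σ ∷ σs) = begin
  t ^ eΛ (σ ∷ σs) A B                    ≡⟨ cong (t ^_) (eΛ-∷ A B σ σs) ⟩
  t ^ (edges A B σ ℕ.+ eΛ σs A B)        ≡⟨ ^-distribˡ-+ t (edges A B σ) (eΛ σs A B) ⟩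
  t ^ edges A B σ * t ^ eΛ σs A B        ≡⟨ cong₂ _*_ (^-edges t A B σ) (^-eΛ t A B σs) ⟩
  weight t B A σ * ∏ σs (weight t B A)   ∎
  where open ≡-Reasoning

-- Markov's inequality

positive-inverse : ∀ v → 0ℚ < v → ∃ λ r → 0ℚ < r × r * v ≡ 1ℚ
positive-inverse v 0<v = ℚ.1/ v , positive⁻¹ (ℚ.1/ v) {{1/pos⇒pos v}} , *-inverseˡ v
  where
  instance
    _ = ℚ.positive 0<v
    _ = pos⇒nonZero v

p<q⇒0<q-p : ∀ {p q} → p < q → 0ℚ < q - p
p<q⇒0<q-p {p} {q} p<q = subst (_< q - p) (+-inverseʳ p) (+-monoˡ-< (- p) p<q)

*-indicator-≤ : ∀ {P : Set} (P? : Dec P) {x y} → (P → x ≤ y) → 0ℚ ≤ y → x * (if does P? then 1ℚ else 0ℚ) ≤ y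
*-indicator-≤ (yes h) {x} {y} le 0≤y = subst (_≤ y) (sym (*-identityʳ x)) (le h)
*-indicator-≤ (no _)  {x} {y} le 0≤y = subst (_≤ y) (sym (*-zeroʳ x)) 0≤y

module _ {n : ℕ} {{_ : ℕ.NonZero n}} (d : ℕ) (A B : Subset n) where

  private
    p : ℚ
    p = ℕ→ℚ (size B) * (ℤ.+ 1 ℚ./ n)

    K : ℕ
    K = d ℕ.* size A

    mean : ℚ → ℚ
    mean t = 1ℚ - p + p * t

    0≤p : 0ℚ ≤ p
    0≤p = 0≤* (0≤ℕ→ℚ (size B)) (0≤1/ n)

    p≤1 : p ≤ 1ℚ
    p≤1 = subst (p ≤_) (ℕ→ℚ-*-1/ n) (*-mono-0≤ʳ _ (0≤1/ n) (ℕ→ℚ-mono (∣p∣≤n B)))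

    np≡b : ℕ→ℚ n * p ≡ ℕ→ℚ (size B)
    np≡b = trans (solve 3 (λ n b i → n :* (b :* i) := b :* (n :* i)) refl (ℕ→ℚ n) (ℕ→ℚ (size B)) (ℤ.+ 1 ℚ./ n))
      (trans (cong (ℕ→ℚ (size B) *_) (ℕ→ℚ-*-1/ n)) (*-identityʳ _))

    total≡n*mean : ∀ t → ℕ→ℚ (size B) * t + ℕ→ℚ (size (∁ B)) ≡ ℕ→ℚ n * mean t
    total≡n*mean t = begin
      b * t + c                                 ≡⟨ solve 3 (λ b c t → b :* t :+ c := (b :+ c) :- b :+ b :* t) refl b c t ⟩
      (b + c) - b + b * t                       ≡⟨ cong₂ (λ n b → n - b + b * t) b+c≡n (sym np≡b) ⟩
      ℕ→ℚ n - ℕ→ℚ n * p + ℕ→ℚ n * p * t         ≡⟨ solve 3 (λ n p t → n :- n :* p :+ n :* p :* t := n :* (con 1ℚ :- p :+ p :* t)) refl (ℕ→ℚ n) p t ⟩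
      ℕ→ℚ n * mean t                            ∎
      where
      open ≡-Reasoning
      b = ℕ→ℚ (size B)
      c = ℕ→ℚ (size (∁ B))
      b+c≡n : b + c ≡ ℕ→ℚ n
      b+c≡n = trans (sym (ℕ→ℚ-+ (size B) (size (∁ B)))) (cong ℕ→ℚ (size+size∁ B))

    μ≡Kp : μ n d A B ≡ ℕ→ℚ K * p
    μ≡Kp = trans (cong (λ y → y * ℕ→ℚ (size A) * ℕ→ℚ (size B)) (/-as-* d n))
      (trans (solve 4 (λ d i a b → d :* i :* a :* b := d :* a :* (b :* i)) refl (ℕ→ℚ d) (ℤ.+ 1 ℚ./ n) (ℕ→ℚ (size A)) (ℕ→ℚ (size B)))
        (cong (_* p) (sym (ℕ→ℚ-* d (size A)))))

    0<n : 0ℚ < ℕ→ℚ n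
    0<n = <-≤-trans (positive⁻¹ 1ℚ) (ℕ→ℚ-mono (ℕ.>-nonZero⁻¹ n))

  -- Certifies that y times the number of samples whose edge count satisfies Q is at most |Ω|.
  record Tail (Q : ℕ → Set) (y : ℚ) : Set where
    field
      majorant    : ℕ → ℚ
      nonNegative : ∀ e → 0ℚ ≤ majorant e
      bound       : ∀ e → Q e → y ≤ majorant e
      expectation : ∑ (Ω n d) (λ σs → majorant (eΛ σs A B)) ≤ ℕ→ℚ (length (Ω n d))

  module _ {t : ℚ} (0≤t : 0ℚ ≤ t) where

    -- `mean t ^ size A` is the generating function of |A| independent trials with success
    -- probability p: drawing without replacement is dominated by drawing with replacement.
    ∑-weight-≤ : ∑ (allPerms n) (weight t B A) ≤ ℕ→ℚ (length (allPerms n)) * mean t ^ size A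
    ∑-weight-≤ = *-cancel-0< (ℕ→ℚ n ^ a) (0<^ a 0<n) (begin
      ℕ→ℚ n ^ a * ∑ (allPerms n) (weight t B A)                         ≡⟨ *-comm (ℕ→ℚ n ^ a) _ ⟩
      ∑ (allPerms n) (weight t B A) * ℕ→ℚ n ^ a                         ≡⟨ cong (_* ℕ→ℚ n ^ a) (∑-allPerms t B A) ⟩
      drawsAt t A (size B) (size (∁ B)) * ℕ→ℚ n ^ a                     ≤⟨ drawsAt-maclaurin t 0≤t A (size B) (size (∁ B)) (size+size∁ B) ⟩
      ℕ→ℚ (n !) * (ℕ→ℚ (size B) * t + ℕ→ℚ (size (∁ B))) ^ a             ≡⟨ cong₂ (λ f W → f * W ^ a) (sym (length-allPerms n)) (total≡n*mean t) ⟩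
      ℕ→ℚ (length (allPerms n)) * (ℕ→ℚ n * mean t) ^ a                  ≡⟨ cong (ℕ→ℚ (length (allPerms n)) *_) (^-distribʳ-* (ℕ→ℚ n) (mean t) a) ⟩
      ℕ→ℚ (length (allPerms n)) * (ℕ→ℚ n ^ a * mean t ^ a)              ≡⟨ solve 3 (λ x y z → x :* (y :* z) := y :* (x :* z)) refl (ℕ→ℚ (length (allPerms n))) (ℕ→ℚ n ^ a) (mean t ^ a) ⟩
      ℕ→ℚ n ^ a * (ℕ→ℚ (length (allPerms n)) * mean t ^ a)              ∎)
      where
      open ≤-Reasoning
      a = size A

    ∑-^-eΛ-≤ : ∑ (Ω n d) (λ σs → t ^ eΛ σs A B) ≤ ℕ→ℚ (length (Ω n d)) * mean t ^ K
    ∑-^-eΛ-≤ = begin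
      ∑ (Ω n d) (λ σs → t ^ eΛ σs A B)                            ≡⟨ ∑-cong (Ω n d) (^-eΛ t A B) ⟩
      ∑ (Ω n d) (λ σs → ∏ σs (weight t B A))                      ≡⟨ ∑-∏ d (allPerms n) (weight t B A) ⟩
      ∑ (allPerms n) (weight t B A) ^ d                           ≤⟨ ^-mono d 0≤∑ ∑-weight-≤ ⟩
      (ℕ→ℚ (length (allPerms n)) * mean t ^ size A) ^ d           ≡⟨ ^-distribʳ-* (ℕ→ℚ (length (allPerms n))) (mean t ^ size A) d ⟩
      ℕ→ℚ (length (allPerms n)) ^ d * (mean t ^ size A) ^ d       ≡⟨ cong₂ _*_ (length-allVecs d (allPerms n)) (^-assoc (mean t) d (size A)) ⟨
      ℕ→ℚ (length (Ω n d)) * mean t ^ K                           ∎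
      where
      open ≤-Reasoning
      0≤∑ : 0ℚ ≤ ∑ (allPerms n) (weight t B A)
      0≤∑ = subst (_≤ ∑ (allPerms n) (weight t B A)) (∑-zero (allPerms n))
        (∑-mono (allPerms n) (λ σ → subst (0ℚ ≤_) (^-edges t A B σ) (0≤^ (edges A B σ) 0≤t)))

    -- The majorant is t^e / (mean t)^K, so a tail only has to supply an inequality between powers
    -- at each value of the edge count.
    markov : 0ℚ < mean t → ∀ {y} {Q : ℕ → Set} → (∀ e → Q e → mean t ^ K * y ≤ t ^ e) → Tail Q y
    markov 0<mean {y} {Q} h = record
      { majorant    = λ e → r ^ K * t ^ e
      ; nonNegative = λ e → 0≤* 0≤r^K (0≤^ e 0≤t)
      ; bound       = λ e Qe → subst (_≤ r ^ K * t ^ e)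
          (trans (sym (*-assoc (r ^ K) (mean t ^ K) y)) (trans (cong (_* y) r^K*mean^K) (*-identityˡ y)))
          (*-mono-0≤ˡ (r ^ K) 0≤r^K (h e Qe))
      ; expectation = begin
          ∑ (Ω n d) (λ σs → r ^ K * t ^ eΛ σs A B)          ≡⟨ ∑-*ˡ (Ω n d) (r ^ K) (λ σs → t ^ eΛ σs A B) ⟩
          r ^ K * ∑ (Ω n d) (λ σs → t ^ eΛ σs A B)          ≤⟨ *-mono-0≤ˡ (r ^ K) 0≤r^K ∑-^-eΛ-≤ ⟩
          r ^ K * (ℕ→ℚ (length (Ω n d)) * mean t ^ K)       ≡⟨ solve 3 (λ x y z → x :* (y :* z) := y :* (x :* z)) refl (r ^ K) (ℕ→ℚ (length (Ω n d))) (mean t ^ K) ⟩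
          ℕ→ℚ (length (Ω n d)) * (r ^ K * mean t ^ K)       ≡⟨ cong (ℕ→ℚ (length (Ω n d)) *_) r^K*mean^K ⟩
          ℕ→ℚ (length (Ω n d)) * 1ℚ                         ≡⟨ *-identityʳ _ ⟩
          ℕ→ℚ (length (Ω n d))                              ∎
      }
      where
      open ≤-Reasoning
      inverse = positive-inverse (mean t) 0<mean
      r = proj₁ inverse
      0≤r^K : 0ℚ ≤ r ^ K
      0≤r^K = 0≤^ K (<⇒≤ (proj₁ (proj₂ inverse)))
      r^K*mean^K : r ^ K * mean t ^ K ≡ 1ℚ
      r^K*mean^K = trans (sym (^-distribʳ-* r (mean t) K)) (trans (cong (_^ K) (proj₂ (proj₂ inverse))) (1^ K))

  -- The mean is a convex combination of 1 and `t`, hence at least `t` when t ≤ 1. It vanishes at t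
  -- = 0, p = 1, which rules out the choice t = 1 - τ at τ = 1.
  mean-pos : ∀ {t} → 0ℚ < t → t ≤ 1ℚ → 0ℚ < mean t
  mean-pos {t} 0<t t≤1 = <-≤-trans 0<t (≤-diff ((1ℚ - p) * (1ℚ - t)) (0≤* (≤⇒0≤- p≤1) (≤⇒0≤- t≤1))
    (solve 2 (λ p t → con 1ℚ :- p :+ p :* t := t :+ (con 1ℚ :- p) :* (con 1ℚ :- t)) refl p t))

  module _ (τ : ℚ) (0≤τ : 0ℚ ≤ τ) (N : ℕ) where

    private
      m E : ℚ
      m = ℕ→ℚ K * p
      E = expPartial N (exponent τ m 0≤τ)

      0<2+τ : 0ℚ < 1ℚ + 1ℚ + τ
      0<2+τ = +-mono-<-≤ {0ℚ} {1ℚ + 1ℚ} (positive⁻¹ (1ℚ + 1ℚ)) 0≤τ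

      instance
        2+τ-pos = ℚ.positive 0<2+τ
        2+τ-nonZero = pos⇒nonZero (1ℚ + 1ℚ + τ)

      -- This reciprocal is the one to which `exponent` unfolds, so the pointwise bounds apply to
      -- `E` definitionally.
      0<q : 0ℚ < ℚ.1/ (1ℚ + 1ℚ + τ)
      0<q = positive⁻¹ _ {{1/pos⇒pos (1ℚ + 1ℚ + τ)}}

      q[2+τ]≡1 : ℚ.1/ (1ℚ + 1ℚ + τ) * (1ℚ + 1ℚ + τ) ≡ 1ℚ
      q[2+τ]≡1 = *-inverseˡ (1ℚ + 1ℚ + τ)

    upper-tail : Tail (λ e → m + τ * m ≤ ℕ→ℚ e) E
    upper-tail = markov (0≤+ 0≤1 0≤τ)
      (<-≤-trans (positive⁻¹ 1ℚ) (≤-diff (p * τ) (0≤* 0≤p 0≤τ)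
        (solve 2 (λ p τ → con 1ℚ :- p :+ p :* (con 1ℚ :+ τ) := con 1ℚ :+ p :* τ) refl p τ)))
      (λ e → upper-pointwise 0≤τ 0<q q[2+τ]≡1 0≤p p≤1 K e N)

    lower-tail : Tail (λ e → ℕ→ℚ e + τ * m ≤ m) E
    lower-tail = [
      (λ τ<1 → let 0<1-τ = p<q⇒0<q-p τ<1 ; inverse = positive-inverse (1ℚ - τ) 0<1-τ in
        markov (<⇒≤ 0<1-τ)
          (mean-pos 0<1-τ (≤-diff τ 0≤τ (solve 1 (λ τ → con 1ℚ := con 1ℚ :- τ :+ τ) refl τ)))
          (λ e → lower-pointwise 0≤τ 0<q q[2+τ]≡1 0≤p p≤1 K e N τ<1 (<⇒≤ (proj₁ (proj₂ inverse))) (proj₂ (proj₂ inverse)))) ,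
      (λ τ≮1 → markov 0≤½ (mean-pos (positive⁻¹ ½) (≤-diff ½ 0≤½ refl))
        (λ e → lower-pointwise′ 0≤τ 0<q q[2+τ]≡1 0≤p p≤1 K e N (≮⇒≥ τ≮1))) ]′
      (toSum (τ <? 1ℚ))

    badCount-bound : ℕ→ℚ (badCount n d A B τ) * expPartial N (exponent τ (μ n d A B) 0≤τ)
      ≤ (1ℚ + 1ℚ) * ℕ→ℚ (length (Ω n d))
    badCount-bound = begin
      ℕ→ℚ (badCount n d A B τ) * expPartial N (exponent τ (μ n d A B) 0≤τ)
        ≡⟨ cong₂ _*_ (trans (sym (∑-one (filter bad? (Ω n d)))) (∑-filter bad? (Ω n d) (λ _ → 1ℚ)))
             (cong (λ m → expPartial N (exponent τ m 0≤τ)) μ≡Kp) ⟩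
      ∑ (Ω n d) 𝟙bad * E
        ≡⟨ *-comm _ E ⟩
      E * ∑ (Ω n d) 𝟙bad
        ≡⟨ ∑-*ˡ (Ω n d) E 𝟙bad ⟨
      ∑ (Ω n d) (λ σs → E * 𝟙bad σs)
        ≤⟨ ∑-mono (Ω n d) pointwise ⟩
      ∑ (Ω n d) (λ σs → f (eΛ σs A B) + g (eΛ σs A B))
        ≡⟨ ∑-+ (Ω n d) (λ σs → f (eΛ σs A B)) (λ σs → g (eΛ σs A B)) ⟩
      ∑ (Ω n d) (λ σs → f (eΛ σs A B)) + ∑ (Ω n d) (λ σs → g (eΛ σs A B))
        ≤⟨ +-mono-≤ (Tail.expectation upper-tail) (Tail.expectation lower-tail) ⟩
      ℕ→ℚ (length (Ω n d)) + ℕ→ℚ (length (Ω n d))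
        ≡⟨ solve 1 (λ x → x :+ x := (con 1ℚ :+ con 1ℚ) :* x) refl (ℕ→ℚ (length (Ω n d))) ⟩
      (1ℚ + 1ℚ) * ℕ→ℚ (length (Ω n d)) ∎
      where
      open ≤-Reasoning
      f g : ℕ → ℚ
      f = Tail.majorant upper-tail
      g = Tail.majorant lower-tail
      0≤f : ∀ e → 0ℚ ≤ f e
      0≤f = Tail.nonNegative upper-tail
      0≤g : ∀ e → 0ℚ ≤ g e
      0≤g = Tail.nonNegative lower-tail
      bad? = λ (σs : Vec (Perm n) d) → τ * μ n d A B ℚ.≤? ∣ ℕ→ℚ (eΛ σs A B) - μ n d A B ∣
      𝟙bad : Vec (Perm n) d → ℚ
      𝟙bad σs = if does (bad? σs) then 1ℚ else 0ℚ
      -- Union bound at the level of majorants: the sign of the deviation selects one tail, and the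
      -- majorant of the other is only added. Each majorant sums to at most |Ω|, whence the factor
      -- 2.
      E≤f+g : ∀ e → τ * m ≤ ∣ ℕ→ℚ e - m ∣ → E ≤ f e + g e
      E≤f+g e h = [ upper , lower ]′ (∣p∣≡p∨∣p∣≡-p (ℕ→ℚ e - m))
        where
        upper : ∣ ℕ→ℚ e - m ∣ ≡ ℕ→ℚ e - m → E ≤ f e + g e
        upper eq = ≤-trans
          (Tail.bound upper-tail e (≤-diff (ℕ→ℚ e - m - τ * m) (≤⇒0≤- (subst (τ * m ≤_) eq h))
            (solve 3 (λ e m x → e := m :+ x :+ (e :- m :- x)) refl (ℕ→ℚ e) m (τ * m))))
          (≤-diff (g e) (0≤g e) refl)
        lower : ∣ ℕ→ℚ e - m ∣ ≡ - (ℕ→ℚ e - m) → E ≤ f e + g e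
        lower eq = ≤-trans
          (Tail.bound lower-tail e (≤-diff (- (ℕ→ℚ e - m) - τ * m) (≤⇒0≤- (subst (τ * m ≤_) eq h))
            (solve 3 (λ e m x → m := e :+ x :+ (:- (e :- m) :- x)) refl (ℕ→ℚ e) m (τ * m))))
          (≤-diff (f e) (0≤f e) (+-comm (f e) (g e)))
      pointwise : ∀ σs → E * 𝟙bad σs ≤ f (eΛ σs A B) + g (eΛ σs A B)
      pointwise σs = *-indicator-≤ (bad? σs)
        (λ h → E≤f+g e (subst (λ m → τ * m ≤ ∣ ℕ→ℚ e - m ∣) μ≡Kp h))
        (0≤+ (0≤f e) (0≤g e))
        where e = eΛ σs A B

theorem1p7 : (n d : ℕ) → {{_ : ℕ.NonZero n}} → 1 ℕ.≤ d →
    (A B : Subset n) (τ : ℚ) (0≤τ : 0ℚ ≤ τ) (N : ℕ) →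
    ℕ→ℚ (badCount n d A B τ) * expPartial N (exponent τ (μ n d A B) 0≤τ)
    ≤ (1ℚ + 1ℚ) * ℕ→ℚ (length (Ω n d))
theorem1p7 n d _ A B τ 0≤τ N = badCount-bound d A B τ 0≤τ N
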